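{- Let $p$ be a binary word of length $l$ with at most $3$ runs. (1) If $p$ is alternating, then $p$ does not have an internal zero at any $n \ge 7$. (2) If $p$ is not alternating, then $p$ has an internal zero at every $n \ge l+3$; in fact $B_{n,p}(M_{n,p}-1) = 0$ for every $n \ge l+3$.
   Context: A binary word is a finite sequence over $\{0,1\}$. An occurrence of $p = p_1\cdots p_l$ in $w = w_1\cdots w_n$ is a choice of indices $1 \le i_1 < \cdots < i_l \le n$ with $w_{i_1}\cdots w_{i_l} = p$; $c_p(w)$ is the number of occurrences, $B_{n,p}(k)$ is the number of binary words $w$ of length $n$ with $c_p(w)=k$, and $M_{n,p} = \max\{c_p(w) : w \in \{0,1\}^n\}$. A run is a maximal block of consecutive equal letters; a word is alternating if all its runs have size $1$. The word $p$ has an internal zero at $n$ if there exist $0 \le k_1 < k_2 < k_3$ with $B_{n,p}(k_1) \ne 0$, $B_{n,p}(k_3) \ne 0$ and $B_{n,p}(k_2) = 0$. -}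

module Defs where

open import Data.Bool using (Bool; true; false; if_then_else_)
open import Data.Bool.Properties using () renaming (_≟_ to _≟ᵇ_)
open import Data.Nat using (ℕ; zero; suc; _+_; _<_; _⊔_)
open import Data.Nat.Properties using (_≟_)
open import Data.List using (List; []; _∷_; _++_; map; length; filter; foldr)
open import Data.List.Relation.Unary.All using (All)
open import Data.Product using (∃-syntax; _×_)
open import Relation.Nullary using (¬_; does)
open import Relation.Binary.PropositionalEquality using (_≡_)

Word : Set
Word = List Bool

-- c p w : number of occurrences of p as a (scattered) subsequence of w,
-- i.e. number of index choices i₁ < ... < i_l with w_{i₁}...w_{i_l} = p.
-- Standard recursion: either the first letter of w is used for the first
-- letter of p (if they agree) or it is not used.
c : Word → Word → ℕ
c [] w = 1
c (a ∷ p) [] = 0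
c (a ∷ p) (b ∷ w) = (if does (a ≟ᵇ b) then c p w else 0) + c (a ∷ p) w

words : ℕ → List Word
words zero = [] ∷ []
words (suc n) = map (false ∷_) (words n) ++ map (true ∷_) (words n)

B : ℕ → Word → ℕ → ℕ
B n p k = length (filter (λ w → c p w ≟ k) (words n))

M : ℕ → Word → ℕ
M n p = foldr _⊔_ 0 (map (c p) (words n))

runsFrom : Bool → ℕ → Word → List ℕ
runsFrom x k [] = k ∷ []
runsFrom x k (y ∷ ys) =
  if does (x ≟ᵇ y) then runsFrom x (suc k) ys else k ∷ runsFrom y 1 ys

runLengths : Word → List ℕ
runLengths [] = []
runLengths (x ∷ xs) = runsFrom x 1 xs

numRuns : Word → ℕ
numRuns p = length (runLengths p)

Alternating : Word → Set
Alternating p = All (_≡ 1) (runLengths p)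

HasInternalZero : ℕ → Word → Set
HasInternalZero n p =
  ∃[ k₁ ] ∃[ k₂ ] ∃[ k₃ ]
    (k₁ < k₂ × k₂ < k₃ × ¬ (B n p k₁ ≡ 0) × ¬ (B n p k₃ ≡ 0) × B n p k₂ ≡ 0)

{-# OPTIONS --safe #-}
module Submission where

-- Write p = x^a y^b x^c with y the other letter; complementing letters reduces every case to x = 0.
--
-- Not alternating: among words with given numbers of zeros and ones, the count is largest when all
-- ones are adjacent, so the maximum is that of C(i,a) C(j,b) C(k,c) over i + j + k = n. A word of count
-- max - 1 falls short of its sorted competitor by 0 or 1; a shortfall of 1 forces the word itself to be
-- sorted (up to small cases with few zeros or ones). So max - 1 would be a value of the product of
-- binomials. By log-concavity such a composition is joined to a maximiser through moves of one unit
-- that keep the value in {max - 1, max}, and two neighbouring values never differ by exactly one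
-- unless two of the exponents are 1, where the maximum is seen to be larger.
--
-- Alternating: for 0 and 01 one swap or letter change lowers the count by one. For 010, a word with 2q
-- zeros and r ones has count r q² minus a sum of r squares, namely of the distances of the ones from the
-- middle. Every D ≤ (r+1)² is a sum of r ≥ 4 squares, and q ≤ r + 1 for the optimal q, so all values
-- from (r-1) q² to r q² occur; smaller ones occur for length n - 1 by induction. Lengths 7 to 11 are
-- checked by evaluation.

open import Defs
open import Data.Bool using (Bool; true; false; not)
open import Data.Bool.Properties using (not-involutive)
open import Data.Empty using (⊥; ⊥-elim)
open import Data.Fin using (Fin; toℕ; fromℕ<)
open import Data.Fin.Properties using (all?; any?; toℕ-fromℕ<)
open import Data.List using (List; []; _∷_; _++_; map; length; replicate; filter; foldr)
open import Data.List.Properties using (length-replicate; length-map; length-++; ++-identityʳ; map-replicate; map-++; map-∘; map-id; map-cong)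
open import Data.List.Membership.Propositional using (_∈_)
open import Data.List.Membership.Propositional.Properties using (∈-map⁻; ∈-map⁺; ∈-++⁺ˡ; ∈-++⁺ʳ; ∈-++⁻; ∈-filter⁺; ∈-filter⁻; foldr-selective)
open import Data.List.Relation.Unary.All using (All; []; _∷_)
open import Data.List.Relation.Unary.Any using (here; there)
open import Data.Nat using (ℕ; zero; suc; _+_; _*_; _∸_; _⊔_; _≤_; _<_; _≤?_; z≤n; s≤s)
open import Data.Nat.Properties
open import Data.List.Membership.DecPropositional _≟_ using (_∈?_)
open import Data.Nat.Combinatorics using (_C_; nCk+nC[k+1]≡[n+1]C[k+1]; nCn≡1; nC1≡n; k>n⇒nCk≡0)
open import Data.Nat.Tactic.RingSolver using (solve-∀)
open import Data.Product using (_×_; _,_; proj₁; proj₂; ∃-syntax)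
open import Data.Sum using (_⊎_; inj₁; inj₂; [_,_]′)
open import Relation.Binary.Definitions using (tri<; tri≈; tri>)
open import Relation.Binary.PropositionalEquality using (_≡_; _≢_; refl; sym; trans; cong; cong₂; subst; subst₂)
open import Relation.Nullary using (¬_; contradiction; yes; no)
open import Relation.Nullary.Decidable using (from-yes)

-- Binomial coefficients

pascal : ∀ n k → suc n C suc k ≡ n C k + n C suc k
pascal n k = sym (nCk+nC[k+1]≡[n+1]C[k+1] n k)

-- This is (k+1) C(n,k+1) = (n-k) C(n,k) with the subtracted term moved to the left, so that it also
-- holds for k > n. Pascal's rule carries the induction.
absorption : ∀ n k → suc k * (n C suc k) + k * (n C k) ≡ n * (n C k)
absorption zero zero = refl
absorption zero (suc k) = trans (cong₂ _+_ (*-zeroʳ (suc (suc k))) (*-zeroʳ (suc k))) refl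
absorption (suc n) zero = trans (rearrange (suc n C 1)) (trans (nC1≡n (suc n)) (sym (*-identityʳ (suc n))))
  where
  rearrange : ∀ u → 1 * u + 0 ≡ u
  rearrange = solve-∀
absorption (suc n) (suc k) rewrite pascal n k | pascal n (suc k) =
  trans (expand k (n C k) (n C suc k) (n C suc (suc k)))
    (trans (cong₂ (λ u v → u + v + (n C suc k) + (n C k)) (absorption n (suc k)) (absorption n k))
      (collect n (n C k) (n C suc k)))
  where
  expand : ∀ k u v w → suc (suc k) * (v + w) + suc k * (u + v)
    ≡ (suc (suc k) * w + suc k * v) + (suc k * v + k * u) + v + u
  expand = solve-∀
  collect : ∀ n u v → n * v + n * u + v + u ≡ suc n * (u + v)
  collect = solve-∀

C-monoˡ : ∀ k {m n} → m ≤ n → m C k ≤ n C k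
C-monoˡ k z≤n = C-minimal k _
  where
  C-minimal : ∀ k n → 0 C k ≤ n C k
  C-minimal zero n = ≤-refl
  C-minimal (suc k) n = z≤n
C-monoˡ zero (s≤s m≤n) = ≤-refl
C-monoˡ (suc k) {suc m} {suc n} (s≤s m≤n) rewrite pascal m k | pascal n k =
  +-mono-≤ (C-monoˡ k m≤n) (C-monoˡ (suc k) m≤n)

C-pos : ∀ {n k} → k ≤ n → 1 ≤ n C k
C-pos {n} {k} k≤n = subst (_≤ n C k) (nCn≡1 k) (C-monoˡ k k≤n)

C-pos⁻¹ : ∀ {n k} → 1 ≤ n C k → k ≤ n
C-pos⁻¹ {n} {k} pos with k ≤? n
... | yes k≤n = k≤n
... | no k≰n = contradiction (subst (1 ≤_) (k>n⇒nCk≡0 (≰⇒> k≰n)) pos) λ ()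

[1+k]Ck≡1+k : ∀ k → suc k C k ≡ suc k
[1+k]Ck≡1+k zero = refl
[1+k]Ck≡1+k (suc k) = trans (pascal (suc k) k)
  (trans (cong₂ _+_ ([1+k]Ck≡1+k k) (nCn≡1 (suc k))) (+-comm (suc k) 1))

k<n⇒k<nCk : ∀ {n k} → k < n → k < n C k
k<n⇒k<nCk {n} {k} k<n = subst (_≤ n C k) ([1+k]Ck≡1+k k) (C-monoˡ k k<n)

1+k<n⇒1+k<nCk : ∀ {n k} → 1 ≤ k → suc k < n → suc k < n C k
1+k<n⇒1+k<nCk {n} {suc k} _ lt = ≤-trans large (C-monoˡ (suc k) lt)
  where
  large : suc (suc k) < suc (suc (suc k)) C suc k
  large rewrite pascal (suc (suc k)) k | [1+k]Ck≡1+k (suc k) =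
    +-monoˡ-≤ (suc (suc k)) (C-pos {suc (suc k)} {k} (m≤n⇒m≤1+n (n≤1+n k)))

nCk≡1⇒n≡k : ∀ {n k} → 1 ≤ k → n C k ≡ 1 → n ≡ k
nCk≡1⇒n≡k {n} {k} 1≤k eq with m≤n⇒m<n∨m≡n (C-pos⁻¹ {n} {k} (≤-reflexive (sym eq)))
... | inj₁ k<n = contradiction (≤-trans (s≤s 1≤k) (≤-trans (k<n⇒k<nCk k<n) (≤-reflexive eq))) λ where (s≤s ())
... | inj₂ k≡n = sym k≡n

-- By `absorption` the ratio C(n,k+1) / C(n,k) is (n-k)/(k+1), which increases with n. Adding k p q
-- to both sides avoids the subtraction.
C-cross : ∀ k {x y} → x ≤ y → (x C suc k) * (y C k) ≤ (x C k) * (y C suc k)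
C-cross k {x} {y} x≤y = *-cancelˡ-≤ (suc k) (+-cancelʳ-≤ (k * (p * q)) _ _ scaled)
  where
  p = x C k
  q = y C k
  p′ = x C suc k
  q′ = y C suc k
  left : ∀ k p p′ q → suc k * (p′ * q) + k * (p * q) ≡ (suc k * p′ + k * p) * q
  left = solve-∀
  right : ∀ k p q q′ → suc k * (p * q′) + k * (p * q) ≡ p * (suc k * q′ + k * q)
  right = solve-∀
  swap : ∀ y p q → y * p * q ≡ p * (y * q)
  swap = solve-∀
  open ≤-Reasoning
  scaled : suc k * (p′ * q) + k * (p * q) ≤ suc k * (p * q′) + k * (p * q)
  scaled = begin
    suc k * (p′ * q) + k * (p * q) ≡⟨ left k p p′ q ⟩
    (suc k * p′ + k * p) * q       ≡⟨ cong (_* q) (absorption x k) ⟩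
    x * p * q                      ≤⟨ *-monoˡ-≤ q (*-monoˡ-≤ p x≤y) ⟩
    y * p * q                      ≡⟨ swap y p q ⟩
    p * (y * q)                    ≡⟨ cong (p *_) (absorption y k) ⟨
    p * (suc k * q′ + k * q)       ≡⟨ right k p q q′ ⟨
    suc k * (p * q′) + k * (p * q) ∎

-- For y = x + 1 this is the usual f(x) f(x+2) ≤ f(x+1)². The form for all x ≤ y divides by no value
-- that may vanish, and it is what moving a unit between two compositions uses.
LogConcave : (ℕ → ℕ) → Set
LogConcave f = ∀ {x y} → x ≤ y → f x * f (suc y) ≤ f (suc x) * f y

-- Pascal's rule at x and at y produces the same term C(x,k+1) C(y,k+1) on both sides; what remains
-- is `C-cross`.
C-logConcave : ∀ k → LogConcave (_C k)
C-logConcave zero _ = ≤-refl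
C-logConcave (suc k) {x} {y} x≤y rewrite pascal x k | pascal y k = begin
  p′ * (q + q′)    ≡⟨ *-distribˡ-+ p′ q q′ ⟩
  p′ * q + p′ * q′ ≤⟨ +-monoˡ-≤ (p′ * q′) (C-cross k x≤y) ⟩
  p * q′ + p′ * q′ ≡⟨ *-distribʳ-+ q′ p p′ ⟨
  (p + p′) * q′    ∎
  where
  open ≤-Reasoning
  p = x C k
  q = y C k
  p′ = x C suc k
  q′ = y C suc k

private
  product-small : ∀ {u v p q} → suc u ≤ p → suc v ≤ q → p * q ≤ suc u * suc v → p ≡ suc u × q ≡ suc v
  product-small {u} {v} {p} {q} u<p v<q pq≤ =
      ≤-antisym (*-cancelʳ-≤ p (suc u) (suc v) (≤-trans (*-monoʳ-≤ p v<q) pq≤)) u<p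
    , ≤-antisym (*-cancelˡ-≤ (suc u) (≤-trans (*-monoˡ-≤ q u<p) pq≤)) v<q

C-absorb-offset : ∀ k s → suc k * ((k + s) C suc k) ≡ s * ((k + s) C k)
C-absorb-offset k s = +-cancelʳ-≡ (k * ((k + s) C k)) _ _
  (trans (absorption (k + s) k) (trans (*-distribʳ-+ ((k + s) C k) k s) (+-comm (k * ((k + s) C k)) _)))

nC[1+n]≡0 : ∀ n → (n + 0) C suc n ≡ 0
nC[1+n]≡0 n = k>n⇒nCk≡0 (s≤s (≤-reflexive (+-identityʳ n)))

C-excess-small : ∀ k s → (k + suc s) C k ≡ suc k → k ≡ 0 ⊎ s ≡ 0
C-excess-small zero s _ = inj₁ refl
C-excess-small (suc k) zero _ = inj₂ refl
C-excess-small (suc k) (suc s) e = contradiction (1+k<n⇒1+k<nCk (s≤s z≤n) (s≤s lt)) (<-irrefl (sym e))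
  where
  lt : suc (suc k) ≤ k + suc (suc s)
  lt = subst (_≤ k + suc (suc s)) (+-comm k 2) (+-monoʳ-≤ k (s≤s (s≤s z≤n)))

-- Absorption turns the hypothesis into C(a+s,a) C(b+t,b) ((a+1) t - (b+1) s) = (a+1) (b+1),
-- while C(a+s,a) ≥ a+1 and C(b+t,b) ≥ b+1.
crossing-by-one : ∀ a b s t → 3 ≤ s + t →
  ((a + s) C a) * ((b + t) C suc b) ≡ suc (((a + s) C suc a) * ((b + t) C b)) → a ≡ 0 × b ≡ 0
crossing-by-one a b s zero _ e =
  contradiction (trans (sym e) (trans (cong (((a + s) C a) *_) (nC[1+n]≡0 b)) (*-zeroʳ ((a + s) C a)))) 1+n≢0
crossing-by-one a b zero (suc t) (s≤s 2≤t) e =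
  -- With s = 0 the product on the right vanishes, so the binomial in b + 1 equals 1. This forces
  -- the second offset to be 1, against the assumption that the offsets sum to at least 3.
  contradiction (nCk≡1⇒n≡k {b + suc t} {suc b} (s≤s z≤n) one) too-long
  where
  one : (b + suc t) C suc b ≡ 1
  one = m*n≡1⇒n≡1 ((a + 0) C a) ((b + suc t) C suc b)
    (trans e (cong (λ u → suc (u * ((b + suc t) C b))) (nC[1+n]≡0 a)))
  too-long : b + suc t ≢ suc b
  too-long eq = contradiction (+-cancelˡ-≡ b _ _ (suc-injective (trans (sym (+-suc b t)) (trans eq (cong suc (sym (+-identityʳ b)))))))
    (m<n⇒n≢0 2≤t)
crossing-by-one a b (suc s) (suc t) 3≤s+t e = conclude (m≤n⇒∃[o]m+o≡n slope)
  where
  p = (a + suc s) C a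
  q = (b + suc t) C b
  p′ = (a + suc s) C suc a
  q′ = (b + suc t) C suc b
  expandˡ : ∀ a b p q′ → suc a * suc b * (p * q′) ≡ (suc a * p) * (suc b * q′)
  expandˡ = solve-∀
  expandʳ : ∀ a b p′ q → suc a * suc b * suc (p′ * q) ≡ suc a * suc b + suc b * (suc a * p′) * q
  expandʳ = solve-∀
  scaled : suc a * suc t * (p * q) ≡ suc a * suc b + suc b * suc s * (p * q)
  scaled = trans (gather a t p q) (trans (cong (suc a * p *_) (sym (C-absorb-offset b (suc t))))
    (trans (sym (expandˡ a b p q′)) (trans (cong (suc a * suc b *_) e) (trans (expandʳ a b p′ q)
      (trans (cong (λ u → suc a * suc b + suc b * u * q) (C-absorb-offset a (suc s))) (regroup (suc a * suc b) b s p q))))))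
    where
    gather : ∀ a t p q → suc a * suc t * (p * q) ≡ (suc a * p) * (suc t * q)
    gather = solve-∀
    regroup : ∀ c b s p q → c + suc b * (suc s * p) * q ≡ c + suc b * suc s * (p * q)
    regroup = solve-∀
  a<p : suc a ≤ p
  a<p = k<n⇒k<nCk (subst (suc a ≤_) (sym (+-suc a s)) (s≤s (m≤m+n a s)))
  b<q : suc b ≤ q
  b<q = k<n⇒k<nCk (subst (suc b ≤_) (sym (+-suc b t)) (s≤s (m≤m+n b t)))
  slope : suc b * suc s < suc a * suc t
  slope = *-cancelʳ-< (p * q) _ _ (subst (suc b * suc s * (p * q) <_) (sym scaled) (m<n+m _ {suc a * suc b} (s≤s z≤n)))
  -- The two slopes differ by d + 1, so (d+1) p q = (a+1)(b+1), while p ≥ a+1 and q ≥ b+1. Hence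
  -- both bounds are equalities and d = 0, and `C-excess-small` leaves four cases.
  conclude : ∃[ d ] suc (suc b * suc s + d) ≡ suc a * suc t → a ≡ 0 × b ≡ 0
  conclude (d , δ) = finish (product-small a<p b<q small)
    where
    difference : suc d * (p * q) ≡ suc a * suc b
    difference = +-cancelʳ-≡ (suc b * suc s * (p * q)) _ _
      (trans (collect d (suc b * suc s) (p * q)) (trans (cong (_* (p * q)) δ) scaled))
      where
      collect : ∀ d u v → suc d * v + u * v ≡ suc (u + d) * v
      collect = solve-∀
    small : p * q ≤ suc a * suc b
    small = ≤-trans (m≤m+n (p * q) (d * (p * q))) (≤-reflexive difference)
    finish : p ≡ suc a × q ≡ suc b → a ≡ 0 × b ≡ 0
    finish (p≡ , q≡) = cases (C-excess-small a s p≡) (C-excess-small b t q≡)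
      where
      d≡0 : d ≡ 0
      d≡0 = m*n≡0⇒m≡0 d (suc a * suc b) (+-cancelˡ-≡ (suc a * suc b) _ _
        (trans (cong (suc d *_) (sym (cong₂ _*_ p≡ q≡))) (trans difference (sym (+-identityʳ _)))))
      exact : suc (suc b * suc s) ≡ suc a * suc t
      exact = trans (cong suc (trans (sym (+-identityʳ _)) (cong (suc b * suc s +_) (sym d≡0)))) δ
      cases : a ≡ 0 ⊎ s ≡ 0 → b ≡ 0 ⊎ t ≡ 0 → a ≡ 0 × b ≡ 0
      cases (inj₁ a≡0) (inj₁ b≡0) = a≡0 , b≡0
      cases (inj₂ refl) (inj₂ refl) = contradiction 3≤s+t λ where (s≤s (s≤s ()))
      cases (inj₁ refl) (inj₂ refl) = contradiction exact λ ()
      cases (inj₂ refl) (inj₁ refl) = a≡0 a exact , refl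
        where
        a≡0 : ∀ a → 2 ≡ suc a * suc t → a ≡ 0
        a≡0 zero _ = refl
        a≡0 (suc a) two = contradiction (≤-trans 3≤s+t (≤-trans (s≤s (m≤m+n (suc t) (a * suc t)))
          (≤-trans (s≤s (m≤n+m _ t)) (≤-reflexive (sym two))))) λ where (s≤s (s≤s ()))

-- Expanding the two larger coefficients by Pascal's rule and cancelling C(i,a+1) C(j,b+1) leaves
-- the equation of `crossing-by-one` with i = a + s and j = b + t. The size condition becomes s + t
-- ≥ 3.
neighbours-differ-by-one : ∀ {a b i j} → suc a + suc b < i + j →
  (suc i C suc a) * (j C suc b) ≡ suc ((i C suc a) * (suc j C suc b)) → a ≡ 0 × b ≡ 0
neighbours-differ-by-one {a} {b} {i} {j} large eq = offsets (m≤n⇒∃[o]m+o≡n a≤i) (m≤n⇒∃[o]m+o≡n b≤j)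
  where
  crossing : (i C a) * (j C suc b) ≡ suc ((i C suc a) * (j C b))
  crossing = +-cancelʳ-≡ ((i C suc a) * (j C suc b)) _ _
    (trans (sym (*-distribʳ-+ (j C suc b) (i C a) (i C suc a)))
      (trans (cong (_* (j C suc b)) (sym (pascal i a)))
        (trans eq (cong suc (trans (cong ((i C suc a) *_) (pascal j b)) (*-distribˡ-+ (i C suc a) (j C b) (j C suc b)))))))
  a≤i : a ≤ i
  a≤i = C-pos⁻¹ {i} {a} (n≢0⇒n>0 λ p≡0 → 1+n≢0 (trans (sym crossing) (cong (_* (j C suc b)) p≡0)))
  b≤j : b ≤ j
  b≤j = <⇒≤ (C-pos⁻¹ {j} {suc b} (n≢0⇒n>0 λ q≡0 →
    1+n≢0 (trans (sym crossing) (trans (cong ((i C a) *_) q≡0) (*-zeroʳ (i C a))))))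
  offsets : ∃[ s ] a + s ≡ i → ∃[ t ] b + t ≡ j → a ≡ 0 × b ≡ 0
  offsets (s , refl) (t , refl) = crossing-by-one a b s t
    (+-cancelˡ-≤ (a + b) _ _ (subst₂ _≤_ (lhs a b) (rhs a b s t) large)) crossing
    where
    lhs : ∀ a b → suc (suc a + suc b) ≡ (a + b) + 3
    lhs = solve-∀
    rhs : ∀ a b s t → (a + s) + (b + t) ≡ (a + b) + (s + t)
    rhs = solve-∀

-- Compositions of n into three parts

-- The constructor ba moves one unit from the second part b to the first part a, and so on.
data Adjacent : ℕ → ℕ → ℕ → ℕ → ℕ → ℕ → Set where
  ba : ∀ {i j k} → Adjacent i (suc j) k (suc i) j k
  ca : ∀ {i j k} → Adjacent i j (suc k) (suc i) j k
  ab : ∀ {i j k} → Adjacent (suc i) j k i (suc j) k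
  cb : ∀ {i j k} → Adjacent i j (suc k) i (suc j) k
  ac : ∀ {i j k} → Adjacent (suc i) j k i j (suc k)
  bc : ∀ {i j k} → Adjacent i (suc j) k i j (suc k)

adjacent-sum : ∀ {i j k i′ j′ k′} → Adjacent i j k i′ j′ k′ → i + j + k ≡ i′ + j′ + k′
adjacent-sum (ba {i} {j} {k}) = lemma i j k
  where
  lemma : ∀ i j k → i + suc j + k ≡ suc i + j + k
  lemma = solve-∀
adjacent-sum (ca {i} {j} {k}) = lemma i j k
  where
  lemma : ∀ i j k → i + j + suc k ≡ suc i + j + k
  lemma = solve-∀
adjacent-sum (ab {i} {j} {k}) = lemma i j k
  where
  lemma : ∀ i j k → suc i + j + k ≡ i + suc j + k
  lemma = solve-∀
adjacent-sum (cb {i} {j} {k}) = lemma i j k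
  where
  lemma : ∀ i j k → i + j + suc k ≡ i + suc j + k
  lemma = solve-∀
adjacent-sum (ac {i} {j} {k}) = lemma i j k
  where
  lemma : ∀ i j k → suc i + j + k ≡ i + j + suc k
  lemma = solve-∀
adjacent-sum (bc {i} {j} {k}) = lemma i j k
  where
  lemma : ∀ i j k → i + suc j + k ≡ i + j + suc k
  lemma = solve-∀

-- Each constructor other than `here` names a part below its target and a part above it. Successors
-- are placed so that the two inequalities are the hypotheses of `LogConcave` for the two parts that
-- change.
data Towards : ℕ → ℕ → ℕ → ℕ → ℕ → ℕ → Set where
  here : ∀ {i j k} → Towards i j k i j k
  ba : ∀ {i p j′ q k k′} → i ≤ p → j′ ≤ q → Towards i (suc q) k (suc p) j′ k′
  ca : ∀ {i p j j′ k′ q} → i ≤ p → k′ ≤ q → Towards i j (suc q) (suc p) j′ k′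
  ab : ∀ {j p i′ q k k′} → j ≤ p → i′ ≤ q → Towards (suc q) j k i′ (suc p) k′
  cb : ∀ {j p k′ q i i′} → j ≤ p → k′ ≤ q → Towards i j (suc q) i′ (suc p) k′
  ac : ∀ {k p i′ q j j′} → k ≤ p → i′ ≤ q → Towards (suc q) j k i′ j′ (suc p)
  bc : ∀ {k p j′ q i i′} → k ≤ p → j′ ≤ q → Towards i (suc q) k i′ j′ (suc p)

towards : ∀ i j k i′ j′ k′ → i + j + k ≡ i′ + j′ + k′ → Towards i j k i′ j′ k′
towards i j k i′ j′ k′ eq with <-cmp i i′ | <-cmp j j′ | <-cmp k k′
... | tri< (s≤s u) _ _ | tri> _ _ (s≤s v) | _ = ba u v
... | tri< (s≤s u) _ _ | _ | tri> _ _ (s≤s v) = ca u v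
... | tri> _ _ (s≤s v) | tri< (s≤s u) _ _ | _ = ab u v
... | _ | tri< (s≤s u) _ _ | tri> _ _ (s≤s v) = cb u v
... | tri> _ _ (s≤s v) | _ | tri< (s≤s u) _ _ = ac u v
... | _ | tri> _ _ (s≤s v) | tri< (s≤s u) _ _ = bc u v
... | tri≈ _ refl _ | tri≈ _ refl _ | tri≈ _ refl _ = here
... | tri< u _ _ | tri< v _ _ | tri< w _ _ = contradiction eq (<⇒≢ (+-mono-< (+-mono-< u v) w))
... | tri< u _ _ | tri< v _ _ | tri≈ _ refl _ = contradiction eq (<⇒≢ (+-monoˡ-< k (+-mono-< u v)))
... | tri< u _ _ | tri≈ _ refl _ | tri< w _ _ = contradiction eq (<⇒≢ (+-mono-< (+-monoˡ-< j u) w))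
... | tri< u _ _ | tri≈ _ refl _ | tri≈ _ refl _ = contradiction eq (<⇒≢ (+-monoˡ-< k (+-monoˡ-< j u)))
... | tri≈ _ refl _ | tri< v _ _ | tri< w _ _ = contradiction eq (<⇒≢ (+-mono-< (+-monoʳ-< i v) w))
... | tri≈ _ refl _ | tri< v _ _ | tri≈ _ refl _ = contradiction eq (<⇒≢ (+-monoˡ-< k (+-monoʳ-< i v)))
... | tri≈ _ refl _ | tri≈ _ refl _ | tri< w _ _ = contradiction eq (<⇒≢ (+-monoʳ-< (i + j) w))
... | tri> _ _ u | tri> _ _ v | tri> _ _ w = contradiction (sym eq) (<⇒≢ (+-mono-< (+-mono-< u v) w))
... | tri> _ _ u | tri> _ _ v | tri≈ _ refl _ = contradiction (sym eq) (<⇒≢ (+-monoˡ-< k (+-mono-< u v)))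
... | tri> _ _ u | tri≈ _ refl _ | tri> _ _ w = contradiction (sym eq) (<⇒≢ (+-mono-< (+-monoˡ-< j u) w))
... | tri> _ _ u | tri≈ _ refl _ | tri≈ _ refl _ = contradiction (sym eq) (<⇒≢ (+-monoˡ-< k (+-monoˡ-< j u)))
... | tri≈ _ refl _ | tri> _ _ v | tri> _ _ w = contradiction (sym eq) (<⇒≢ (+-mono-< (+-monoʳ-< i v) w))
... | tri≈ _ refl _ | tri> _ _ v | tri≈ _ refl _ = contradiction (sym eq) (<⇒≢ (+-monoˡ-< k (+-monoʳ-< i v)))
... | tri≈ _ refl _ | tri≈ _ refl _ | tri> _ _ w = contradiction (sym eq) (<⇒≢ (+-monoʳ-< (i + j) w))

-- The exchange property: moving a unit of a composition z towards a maximiser y, and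
-- one of y back towards z, does not decrease the product of the two values. Hence from
-- a composition of value one below the maximum one reaches the maximum without leaving
-- these two values, and some step has to cross between them.
module Exchange
  (f g h : ℕ → ℕ) (f-lc : LogConcave f) (g-lc : LogConcave g) (h-lc : LogConcave h)
  (n m : ℕ)
  (bound : ∀ i j k → i + j + k ≡ n → f i * g j * h k ≤ m)
  where

  value : ℕ → ℕ → ℕ → ℕ
  value i j k = f i * g j * h k

  private
    -- Here (m-1) m ≤ x′ y′ ≤ x′ m, and cancelling m gives x′ ≥ m-1.
    one-below : ∀ {x y x′ y′} → x * y ≤ x′ * y′ → x′ ≤ m → y′ ≤ m → suc x ≡ m → y ≡ m → suc x′ ≡ m ⊎ x′ ≡ m
    one-below {x} {x′ = x′} le x′≤m y′≤m refl refl with m≤n⇒m<n∨m≡n x′≤m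
    ... | inj₂ eq = inj₂ eq
    ... | inj₁ (s≤s x′≤x) = inj₁ (cong suc (≤-antisym x′≤x (*-cancelʳ-≤ x x′ (suc x) (≤-trans le (*-monoʳ-≤ x′ y′≤m)))))

    exchange : ∀ φ ψ → LogConcave φ → LogConcave ψ → ∀ {i p j q} → i ≤ p → j ≤ q → ∀ r →
      φ i * φ (suc p) * (ψ (suc q) * ψ j) * r ≤ φ (suc i) * φ p * (ψ q * ψ (suc j)) * r
    exchange φ ψ φ-lc ψ-lc {j = j} {q} u v r =
      *-monoˡ-≤ r (*-mono-≤ (φ-lc u) (subst₂ _≤_ (*-comm (ψ j) (ψ (suc q))) (*-comm (ψ (suc j)) (ψ q)) (ψ-lc v)))

    raise : ∀ {i p} → i ≤ p → i ∸ suc p ≡ i ∸ p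
    raise u = trans (m≤n⇒m∸n≡0 (m≤n⇒m≤1+n u)) (sym (m≤n⇒m∸n≡0 u))

    lower : ∀ {j q} → j ≤ q → suc q ∸ j ≡ suc (q ∸ j)
    lower = +-∸-assoc 1

    excess₁ : ∀ {x x′ y y′ z z′ d} → x ≡ suc x′ → y ≡ y′ → z ≡ z′ → x + y + z ≤ d → x′ + y′ + z′ < d
    excess₁ refl refl refl le = le
    excess₂ : ∀ {x x′ y y′ z z′ d} → x ≡ x′ → y ≡ suc y′ → z ≡ z′ → x + y + z ≤ d → x′ + y′ + z′ < d
    excess₂ {x} {y′ = y} {z} {d = d} refl refl refl = subst (_≤ d) (cong (_+ z) (+-suc x y))
    excess₃ : ∀ {x x′ y y′ z z′ d} → x ≡ x′ → y ≡ y′ → z ≡ suc z′ → x + y + z ≤ d → x′ + y′ + z′ < d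
    excess₃ {x} {y = y} {z′ = z} {d} refl refl refl = subst (_≤ d) (+-suc (x + y) z)

    pair₁₂ : ∀ u x r v w s → u * x * r * (v * w * s) ≡ u * v * (x * w) * (r * s)
    pair₁₂ = solve-∀
    pair₂₁ : ∀ x u r w v s → x * u * r * (w * v * s) ≡ u * v * (x * w) * (r * s)
    pair₂₁ = solve-∀
    pair₁₃ : ∀ u r x v s w → u * r * x * (v * s * w) ≡ u * v * (x * w) * (r * s)
    pair₁₃ = solve-∀
    pair₃₁ : ∀ x r u w s v → x * r * u * (w * s * v) ≡ u * v * (x * w) * (r * s)
    pair₃₁ = solve-∀
    pair₂₃ : ∀ r u x s v w → r * u * x * (s * v * w) ≡ u * v * (x * w) * (r * s)
    pair₂₃ = solve-∀
    pair₃₂ : ∀ r x u s w v → r * x * u * (s * w * v) ≡ u * v * (x * w) * (r * s)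
    pair₃₂ = solve-∀

  no-path : (∀ {i j k i′ j′ k′} → Adjacent i j k i′ j′ k′ → i + j + k ≡ n → suc (value i j k) ≡ m → value i′ j′ k′ ≢ m) →
    ∀ {i′ j′ k′} → i′ + j′ + k′ ≡ n → value i′ j′ k′ ≡ m →
    ∀ {i j k} → i + j + k ≡ n → suc (value i j k) ≢ m
  no-path gap {i′} {j′} {k′} y-sum y-max {i} {j} {k} = go _ i j k i′ j′ k′ (n<1+n _) y-sum y-max
    where
    -- Only the lower composition moves; `d` bounds its truncated excess over the fixed maximiser. A
    -- step lowers the excess of the giving part by one, and the receiving part has excess 0 before
    -- and after.
    go : ∀ d i j k i′ j′ k′ → (i ∸ i′) + (j ∸ j′) + (k ∸ k′) < d → i′ + j′ + k′ ≡ n → value i′ j′ k′ ≡ m →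
      i + j + k ≡ n → suc (value i j k) ≢ m
    step : ∀ d {i j k i₁ j₁ k₁ i′ j′ k′ i″ j″ k″} → Adjacent i j k i₁ j₁ k₁ → Adjacent i′ j′ k′ i″ j″ k″ →
      value i j k * value i′ j′ k′ ≤ value i₁ j₁ k₁ * value i″ j″ k″ →
      (i₁ ∸ i′) + (j₁ ∸ j′) + (k₁ ∸ k′) < d → i′ + j′ + k′ ≡ n → value i′ j′ k′ ≡ m →
      i + j + k ≡ n → suc (value i j k) ≢ m
    step d {i₁ = i₁} {j₁} {k₁} {i′} {j′} {k′} {i″} {j″} {k″} adj adj′ le ex y-sum y-max z-sum z-below
      with one-below le (bound i₁ j₁ k₁ (trans (sym (adjacent-sum adj)) z-sum))
             (bound i″ j″ k″ (trans (sym (adjacent-sum adj′)) y-sum)) z-below y-max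
    ... | inj₁ below = go d i₁ j₁ k₁ i′ j′ k′ ex y-sum y-max (trans (sym (adjacent-sum adj)) z-sum) below
    ... | inj₂ max = gap adj z-sum z-below max
    go (suc d) i j k i′ j′ k′ (s≤s ex) y-sum y-max z-sum z-below
      with towards i j k i′ j′ k′ (trans z-sum (sym y-sum))
    ... | here = 1+n≢n (trans z-below (sym y-max))
    ... | ba {p = p} {q = q} u v
      = step d ba ab
          (subst₂ _≤_ (sym (pair₁₂ (f i) (g (suc q)) (h k) (f (suc p)) (g j′) (h k′))) (sym (pair₁₂ (f (suc i)) (g q) (h k) (f p) (g (suc j′)) (h k′)))
            (exchange f g f-lc g-lc u v (h k * h k′)))
          (excess₂ (raise u) (lower v) refl ex) y-sum y-max z-sum z-below
    ... | ab {p = p} {q = q} u v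
      = step d ab ba
          (subst₂ _≤_ (sym (pair₂₁ (f (suc q)) (g j) (h k) (f i′) (g (suc p)) (h k′))) (sym (pair₂₁ (f q) (g (suc j)) (h k) (f (suc i′)) (g p) (h k′)))
            (exchange g f g-lc f-lc u v (h k * h k′)))
          (excess₁ (lower v) (raise u) refl ex) y-sum y-max z-sum z-below
    ... | ca {p = p} {q = q} u v
      = step d ca ac
          (subst₂ _≤_ (sym (pair₁₃ (f i) (g j) (h (suc q)) (f (suc p)) (g j′) (h k′))) (sym (pair₁₃ (f (suc i)) (g j) (h q) (f p) (g j′) (h (suc k′))))
            (exchange f h f-lc h-lc u v (g j * g j′)))
          (excess₃ (raise u) refl (lower v) ex) y-sum y-max z-sum z-below
    ... | ac {p = p} {q = q} u v
      = step d ac ca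
          (subst₂ _≤_ (sym (pair₃₁ (f (suc q)) (g j) (h k) (f i′) (g j′) (h (suc p)))) (sym (pair₃₁ (f q) (g j) (h (suc k)) (f (suc i′)) (g j′) (h p)))
            (exchange h f h-lc f-lc u v (g j * g j′)))
          (excess₁ (lower v) refl (raise u) ex) y-sum y-max z-sum z-below
    ... | cb {p = p} {q = q} u v
      = step d cb bc
          (subst₂ _≤_ (sym (pair₂₃ (f i) (g j) (h (suc q)) (f i′) (g (suc p)) (h k′))) (sym (pair₂₃ (f i) (g (suc j)) (h q) (f i′) (g p) (h (suc k′))))
            (exchange g h g-lc h-lc u v (f i * f i′)))
          (excess₃ refl (raise u) (lower v) ex) y-sum y-max z-sum z-below
    ... | bc {p = p} {q = q} u v
      = step d bc cb
          (subst₂ _≤_ (sym (pair₃₂ (f i) (g (suc q)) (h k) (f i′) (g j′) (h (suc p)))) (sym (pair₃₂ (f i) (g q) (h (suc k)) (f i′) (g (suc j′)) (h p)))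
            (exchange h g h-lc g-lc u v (f i * f i′)))
          (excess₂ refl (lower v) (raise u) ex) y-sum y-max z-sum z-below

-- Products of three binomial coefficients never equal the maximum minus one

weight : ℕ → ℕ → ℕ → ℕ → ℕ → ℕ → ℕ
weight a b c i j k = (i C a) * (j C b) * (k C c)

-- Two multiples of `z` that differ by 1 make `z` a divisor of 1.
unit-difference : ∀ {x y z} → suc (x * z) ≡ y * z → z ≡ 1 × suc x ≡ y
unit-difference {x} {y} {z} e = z≡1 , suc-x≡y
  where
  x<y : x < y
  x<y = *-cancelʳ-< z x y (≤-reflexive e)
  z≡1 : z ≡ 1
  z≡1 with m≤n⇒∃[o]m+o≡n x<y
  ... | d , refl = m*n≡1⇒n≡1 (suc d) z (+-cancelˡ-≡ (x * z) _ _ (trans (expand x d z) (trans (sym e) (+-comm 1 (x * z)))))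
    where
    expand : ∀ x d z → x * z + suc d * z ≡ suc (x + d) * z
    expand = solve-∀
  suc-x≡y : suc x ≡ y
  suc-x≡y = subst₂ (λ u v → suc u ≡ v) (*-identityʳ x) (*-identityʳ y) (subst (λ u → suc (x * u) ≡ y * u) z≡1 e)

private
  weight-swap₁₂ : ∀ a b c i j k → weight a b c i j k ≡ weight b a c j i k
  weight-swap₁₂ a b c i j k = cong (_* (k C c)) (*-comm (i C a) (j C b))

  weight-swap₂₃ : ∀ a b c i j k → weight a b c i j k ≡ weight a c b i k j
  weight-swap₂₃ a b c i j k = perm (i C a) (j C b) (k C c)
    where
    perm : ∀ u v w → u * v * w ≡ u * w * v
    perm = solve-∀

IsBound : ℕ → ℕ → ℕ → ℕ → ℕ → Set
IsBound a b c n m = ∀ i j k → i + j + k ≡ n → weight a b c i j k ≤ m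

private
  bound-swap₁₂ : ∀ {a b c n m} → IsBound a b c n m → IsBound b a c n m
  bound-swap₁₂ {a} {b} {c} {m = m} bound i j k e =
    subst (_≤ m) (sym (weight-swap₁₂ b a c i j k)) (bound j i k (trans (cong (_+ k) (+-comm j i)) e))

  bound-swap₂₃ : ∀ {a b c n m} → IsBound a b c n m → IsBound a c b n m
  bound-swap₂₃ {a} {b} {c} {m = m} bound i j k e =
    subst (_≤ m) (sym (weight-swap₂₃ a c b i j k)) (bound i k j (trans (perm i k j) e))
    where
    perm : ∀ u v w → u + v + w ≡ u + w + v
    perm = solve-∀

  -- Let e ≥ 2 be the third exponent. The equation forces j = i + 1, so the supposed maximum is
  -- (i+1)². Moving a unit from the second part to the third gives (i+1) i (e+1), which is larger
  -- once i ≥ 1; the length excludes i = 0.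
  linear-parts-absurd : ∀ c i j → c ≢ 0 → 2 + suc c + 3 ≤ i + suc j + suc c → suc (i * suc j) ≡ suc i * j →
    IsBound 1 1 (suc c) (i + suc j + suc c) (weight 1 1 (suc c) (suc i) j (suc c)) → ⊥
  linear-parts-absurd zero i j c≢0 _ _ _ = c≢0 refl
  linear-parts-absurd (suc c) i j _ large step bound with +-cancelʳ-≡ (i * j) _ _ (trans (expand i j) step)
    where
    expand : ∀ i j → suc i + i * j ≡ suc (i * suc j)
    expand = solve-∀
  ... | refl = too-small i large (*-cancelˡ-≤ (suc i) (subst₂ _≤_ left right (bound (suc i) i (suc (suc (suc c))) (sum i c))))
    where
    sum : ∀ i c → suc i + i + suc (suc (suc c)) ≡ i + suc (suc i) + suc (suc c)
    sum = solve-∀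
    assoc : ∀ u v w → suc u * v * w ≡ suc u * (v * w)
    assoc = solve-∀
    left : weight 1 1 (suc (suc c)) (suc i) i (suc (suc (suc c))) ≡ suc i * (i * suc (suc (suc c)))
    left = trans (cong₂ _*_ (cong₂ _*_ (nC1≡n (suc i)) (nC1≡n i)) ([1+k]Ck≡1+k (suc (suc c)))) (assoc i i _)
    right : weight 1 1 (suc (suc c)) (suc i) (suc i) (suc (suc c)) ≡ suc i * suc i
    right = trans (cong₂ _*_ (cong₂ _*_ (nC1≡n (suc i)) (nC1≡n (suc i))) (nCn≡1 (suc (suc c)))) (*-identityʳ _)
    too-small : ∀ i → 2 + suc (suc c) + 3 ≤ i + suc (suc i) + suc (suc c) → ¬ i * suc (suc (suc c)) ≤ suc i
    too-small zero large _ = contradiction (+-cancelʳ-≤ (suc (suc c)) 5 2 (≤-trans (≤-reflexive (shift c)) large)) λ where (s≤s (s≤s ()))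
      where
      shift : ∀ c → 5 + suc (suc c) ≡ 2 + suc (suc c) + 3
      shift = solve-∀
    too-small (suc i) _ (s≤s (s≤s le)) = contradiction le (<⇒≱ (s≤s (m≤n⇒m≤o+n c (≤-trans (m≤m*n i (suc (suc (suc c)))) ≤-refl))))

  size : ∀ a b c i j → suc a + suc b + suc c + 3 ≤ i + suc j + suc c → suc a + suc b < i + j
  size a b c i j large = +-cancelʳ-≤ (suc (suc c)) _ _ (≤-trans (≤-reflexive (lhs a b c))
    (≤-trans (+-monoʳ-≤ (suc a + suc b + suc c) (n≤1+n 2)) (≤-trans large (≤-reflexive (rhs i j c)))))
    where
    lhs : ∀ a b c → suc (suc a + suc b) + suc (suc c) ≡ suc a + suc b + suc c + 2
    lhs = solve-∀
    rhs : ∀ i j c → i + suc j + suc c ≡ i + j + suc (suc c)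
    rhs = solve-∀

  -- The factor C(k,c+1) is common to both values, hence equals 1 and k = c + 1. The remaining
  -- two-factor step is by one, so `neighbours-differ-by-one` gives a = b = 0, the case of
  -- `linear-parts-absurd`.
  adjacent-to-max : ∀ a b c {n m i j k} → ¬ (a ≡ 0 × b ≡ 0 × c ≡ 0) → suc a + suc b + suc c + 3 ≤ n →
    IsBound (suc a) (suc b) (suc c) n m → i + suc j + k ≡ n →
    suc (weight (suc a) (suc b) (suc c) i (suc j) k) ≡ m → weight (suc a) (suc b) (suc c) (suc i) j k ≢ m
  adjacent-to-max a b c {n} {m} {i} {j} {k} nontrivial large bound refl below refl
    with unit-difference {(i C suc a) * (suc j C suc b)} {(suc i C suc a) * (j C suc b)} {k C suc c} below
  ... | kC≡1 , step with nCk≡1⇒n≡k {k} {suc c} (s≤s z≤n) kC≡1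
  ... | refl with neighbours-differ-by-one {a} {b} {i} {j} (size a b c i j large) (sym step)
  ... | refl , refl = linear-parts-absurd c i j (λ c≡0 → nontrivial (refl , refl , c≡0)) large
        (subst₂ (λ u v → suc (u * v) ≡ suc i * j) (nC1≡n i) (nC1≡n (suc j)) (trans step (cong₂ _*_ (nC1≡n (suc i)) (nC1≡n j)))) bound

no-weight-below-max : ∀ a b c {n m} → ¬ (a ≡ 0 × b ≡ 0 × c ≡ 0) → suc a + suc b + suc c + 3 ≤ n →
  IsBound (suc a) (suc b) (suc c) n m →
  ∀ i′ j′ k′ → i′ + j′ + k′ ≡ n → weight (suc a) (suc b) (suc c) i′ j′ k′ ≡ m →
  ∀ i j k → i + j + k ≡ n → suc (weight (suc a) (suc b) (suc c) i j k) ≢ m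
no-weight-below-max a b c {n} {m} nontrivial large bound i′ j′ k′ y-sum y-max i j k =
  no-path gap {i′} {j′} {k′} y-sum y-max {i} {j} {k}
  where
  open Exchange (_C suc a) (_C suc b) (_C suc c) (C-logConcave (suc a)) (C-logConcave (suc b)) (C-logConcave (suc c)) n m bound
  -- The weight is symmetric under permuting exponents together with parts, so every move reduces to
  -- the one from the second part to the first.
  via : ∀ x y z {i j k w w′} → suc x + suc y + suc z ≡ suc a + suc b + suc c → ¬ (x ≡ 0 × y ≡ 0 × z ≡ 0) →
    IsBound (suc x) (suc y) (suc z) n m → i + suc j + k ≡ n →
    w ≡ weight (suc x) (suc y) (suc z) i (suc j) k → w′ ≡ weight (suc x) (suc y) (suc z) (suc i) j k →
    suc w ≡ m → w′ ≢ m
  via x y z {i} {j} {k} sum nontriv bnd sum′ refl refl =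
    adjacent-to-max x y z {i = i} {j} {k} nontriv (subst (λ s → s + 3 ≤ n) (sym sum) large) bnd sum′
  gap : ∀ {i j k i′ j′ k′} → Adjacent i j k i′ j′ k′ → i + j + k ≡ n → suc (value i j k) ≡ m → value i′ j′ k′ ≢ m
  gap (ba {i} {j} {k}) sum below max = adjacent-to-max a b c {i = i} {j} {k} nontrivial large bound sum below max
  gap (ab {i} {j} {k}) sum = via b a c (perm a b c) (λ (q , p , r) → nontrivial (p , q , r))
    (bound-swap₁₂ {suc a} {suc b} {suc c} bound) (trans (perm-sum i j k) sum)
    (weight-swap₁₂ (suc a) (suc b) (suc c) (suc i) j k)
    (weight-swap₁₂ (suc a) (suc b) (suc c) i (suc j) k)
    where
    perm : ∀ a b c → suc b + suc a + suc c ≡ suc a + suc b + suc c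
    perm = solve-∀
    perm-sum : ∀ i j k → j + suc i + k ≡ suc i + j + k
    perm-sum = solve-∀
  gap (ca {i} {j} {k}) sum = via a c b (perm a b c) (λ (p , r , q) → nontrivial (p , q , r))
    (bound-swap₂₃ {suc a} {suc b} {suc c} bound) (trans (perm-sum i j k) sum)
    (weight-swap₂₃ (suc a) (suc b) (suc c) i j (suc k))
    (weight-swap₂₃ (suc a) (suc b) (suc c) (suc i) j k)
    where
    perm : ∀ a b c → suc a + suc c + suc b ≡ suc a + suc b + suc c
    perm = solve-∀
    perm-sum : ∀ i j k → i + suc k + j ≡ i + j + suc k
    perm-sum = solve-∀
  gap (ac {i} {j} {k}) sum = via c a b (perm a b c) (λ (r , p , q) → nontrivial (p , q , r))
    (bound-swap₁₂ {suc a} {suc c} {suc b} (bound-swap₂₃ {suc a} {suc b} {suc c} bound)) (trans (perm-sum i j k) sum)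
    (trans (weight-swap₂₃ (suc a) (suc b) (suc c) (suc i) j k) (weight-swap₁₂ (suc a) (suc c) (suc b) (suc i) k j))
    (trans (weight-swap₂₃ (suc a) (suc b) (suc c) i j (suc k)) (weight-swap₁₂ (suc a) (suc c) (suc b) i (suc k) j))
    where
    perm : ∀ a b c → suc c + suc a + suc b ≡ suc a + suc b + suc c
    perm = solve-∀
    perm-sum : ∀ i j k → k + suc i + j ≡ suc i + j + k
    perm-sum = solve-∀
  gap (cb {i} {j} {k}) sum = via b c a (perm a b c) (λ (q , r , p) → nontrivial (p , q , r))
    (bound-swap₂₃ {suc b} {suc a} {suc c} (bound-swap₁₂ {suc a} {suc b} {suc c} bound)) (trans (perm-sum i j k) sum)
    (trans (weight-swap₁₂ (suc a) (suc b) (suc c) i j (suc k)) (weight-swap₂₃ (suc b) (suc a) (suc c) j i (suc k)))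
    (trans (weight-swap₁₂ (suc a) (suc b) (suc c) i (suc j) k) (weight-swap₂₃ (suc b) (suc a) (suc c) (suc j) i k))
    where
    perm : ∀ a b c → suc b + suc c + suc a ≡ suc a + suc b + suc c
    perm = solve-∀
    perm-sum : ∀ i j k → j + suc k + i ≡ i + j + suc k
    perm-sum = solve-∀
  gap (bc {i} {j} {k}) sum = via c b a (perm a b c) (λ (r , q , p) → nontrivial (p , q , r))
    (bound-swap₁₂ {suc b} {suc c} {suc a} (bound-swap₂₃ {suc b} {suc a} {suc c} (bound-swap₁₂ {suc a} {suc b} {suc c} bound))) (trans (perm-sum i j k) sum)
    (trans (weight-swap₁₂ (suc a) (suc b) (suc c) i (suc j) k) (trans (weight-swap₂₃ (suc b) (suc a) (suc c) (suc j) i k) (weight-swap₁₂ (suc b) (suc c) (suc a) (suc j) k i)))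
    (trans (weight-swap₁₂ (suc a) (suc b) (suc c) i j (suc k)) (trans (weight-swap₂₃ (suc b) (suc a) (suc c) j i (suc k)) (weight-swap₁₂ (suc b) (suc c) (suc a) j (suc k) i)))
    where
    perm : ∀ a b c → suc c + suc b + suc a ≡ suc a + suc b + suc c
    perm = solve-∀
    perm-sum : ∀ i j k → k + suc j + i ≡ i + suc j + k
    perm-sum = solve-∀

-- The two-part case is the three-part one whose last factor is the indicator of 0.
no-product-below-max : ∀ a b {n m} → ¬ (a ≡ 0 × b ≡ 0) → suc a + suc b + 2 ≤ n →
  (∀ i j → i + j ≡ n → (i C suc a) * (j C suc b) ≤ m) →
  ∀ i′ j′ → i′ + j′ ≡ n → (i′ C suc a) * (j′ C suc b) ≡ m →
  ∀ i j → i + j ≡ n → suc ((i C suc a) * (j C suc b)) ≢ m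
no-product-below-max a b {n} {m} nontrivial large bound i′ j′ y-sum y-max i j z-sum z-below =
  no-path gap {i′} {j′} {0} (trans (+-identityʳ _) y-sum) (trans (*-identityʳ _) y-max)
    {i} {j} {0} (trans (+-identityʳ _) z-sum) (trans (cong suc (*-identityʳ _)) z-below)
  where
  indicator-lc : LogConcave (0 C_)
  indicator-lc {x} {y} _ = ≤-trans (≤-reflexive (*-zeroʳ (0 C x))) z≤n
  bound₃ : ∀ i j k → i + j + k ≡ n → (i C suc a) * (j C suc b) * (0 C k) ≤ m
  bound₃ i j zero e = ≤-trans (≤-reflexive (*-identityʳ _)) (bound i j (trans (sym (+-identityʳ _)) e))
  bound₃ i j (suc k) e = ≤-trans (≤-reflexive (*-zeroʳ ((i C suc a) * (j C suc b)))) z≤n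
  open Exchange (_C suc a) (_C suc b) (0 C_) (C-logConcave (suc a)) (C-logConcave (suc b)) (λ {x} {y} → indicator-lc {x} {y}) n m bound₃
  1<m : 1 < m
  1<m with m≤n⇒∃[o]m+o≡n large
  ... | d , refl = ≤-trans
    (≤-trans (s≤s (s≤s z≤n)) (≤-trans (k<n⇒k<nCk {suc a + 2 + d} {suc a} (≤-trans (s≤s (m≤n⇒m≤n+o d (m≤m+n (suc a) 1))) (≤-reflexive (shift a d)))) (≤-reflexive (sym (trans (cong (((suc a + 2 + d) C suc a) *_) (nCn≡1 (suc b))) (*-identityʳ _))))))
    (bound (suc a + 2 + d) (suc b) (sum a b d))
    where
    shift : ∀ a d → suc (suc a + 1 + d) ≡ suc a + 2 + d
    shift = solve-∀
    sum : ∀ a b d → suc a + 2 + d + suc b ≡ suc a + suc b + 2 + d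
    sum = solve-∀
  -- A nonzero third part makes the value 0. Since 1 < m, such a composition has neither value m-1
  -- nor m, so only moves between the first two parts matter.
  zero-part : ∀ x → suc (x * 0) ≢ m
  zero-part x e = <-irrefl (trans (cong suc (sym (*-zeroʳ x))) e) 1<m
  zero-max : ∀ x → x * 0 ≢ m
  zero-max x e = n≮0 (subst (1 <_) (trans (sym e) (*-zeroʳ x)) 1<m)
  room : ∀ i j → i + suc j + 0 ≡ n → suc a + suc b < i + j
  room i j refl = +-cancelʳ-≤ 1 _ _ (≤-trans (≤-reflexive (lhs a b)) (≤-trans large (≤-reflexive (rhs i j))))
    where
    lhs : ∀ a b → suc (suc a + suc b) + 1 ≡ suc a + suc b + 2
    lhs = solve-∀
    rhs : ∀ i j → i + suc j + 0 ≡ i + j + 1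
    rhs = solve-∀
  gap : ∀ {i j k i′ j′ k′} → Adjacent i j k i′ j′ k′ → i + j + k ≡ n → suc (value i j k) ≡ m → value i′ j′ k′ ≢ m
  gap (ca {i} {j}) _ below _ = zero-part ((i C suc a) * (j C suc b)) below
  gap (cb {i} {j}) _ below _ = zero-part ((i C suc a) * (j C suc b)) below
  gap (ac {i} {j}) _ _ max = zero-max ((i C suc a) * (j C suc b)) max
  gap (bc {i} {j}) _ _ max = zero-max ((i C suc a) * (j C suc b)) max
  gap (ba {i} {j} {suc k}) _ below _ = zero-part ((i C suc a) * (suc j C suc b)) below
  gap (ab {i} {j} {suc k}) _ below _ = zero-part ((suc i C suc a) * (j C suc b)) below
  gap (ba {i} {j} {zero}) sum below max = nontrivial (neighbours-differ-by-one {a} {b} {i} {j} (room i j sum)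
    (subst₂ (λ u v → u ≡ suc v) (*-identityʳ _) (*-identityʳ _) (trans max (sym below))))
  gap (ab {i} {j} {zero}) sum below max = nontrivial ((λ (b≡0 , a≡0) → a≡0 , b≡0) (neighbours-differ-by-one {b} {a} {j} {i}
    (subst₂ _<_ (+-comm (suc a) (suc b)) (+-comm i j) (room i j (trans (shift i j) sum)))
    (subst₂ (λ u v → u ≡ suc v) (trans (*-identityʳ _) (*-comm (i C suc a) (suc j C suc b))) (trans (*-identityʳ _) (*-comm (suc i C suc a) (j C suc b))) (trans max (sym below)))))
    where
    shift : ∀ i j → i + suc j + 0 ≡ suc i + j + 0
    shift = solve-∀

-- Counting occurrences of words with few runs

zeros ones : Word → ℕ
zeros = c (false ∷ [])
ones = c (true ∷ [])

ones+zeros : ∀ w → ones w + zeros w ≡ length w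
ones+zeros [] = refl
ones+zeros (true ∷ w) = cong suc (ones+zeros w)
ones+zeros (false ∷ w) = trans (+-suc (ones w) (zeros w)) (cong suc (ones+zeros w))

blocks₂ : ℕ → ℕ → Word
blocks₂ b k = replicate b true ++ replicate k false

blocks₃ : ℕ → ℕ → ℕ → Word
blocks₃ a b k = replicate a false ++ blocks₂ b k

c-zeros : ∀ k w → c (replicate k false) w ≡ zeros w C k
c-zeros zero w = refl
c-zeros (suc k) [] = refl
c-zeros (suc k) (true ∷ w) = c-zeros (suc k) w
c-zeros (suc k) (false ∷ w) = trans (cong₂ _+_ (c-zeros k w) (c-zeros (suc k) w)) (sym (pascal (zeros w) k))

-- An occurrence is a choice of b ones and k zeros; the right side counts all such choices, whatever
-- their order.
c-blocks₂-≤ : ∀ b k w → c (blocks₂ b k) w ≤ (ones w C b) * (zeros w C k)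
c-blocks₂-≤ zero k w = ≤-reflexive (trans (c-zeros k w) (sym (+-identityʳ _)))
c-blocks₂-≤ (suc b) k [] = z≤n
c-blocks₂-≤ (suc b) k (true ∷ w) rewrite pascal (ones w) b | *-distribʳ-+ (zeros w C k) (ones w C b) (ones w C suc b) =
  +-mono-≤ (c-blocks₂-≤ b k w) (c-blocks₂-≤ (suc b) k w)
c-blocks₂-≤ (suc b) k (false ∷ w) =
  ≤-trans (c-blocks₂-≤ (suc b) k w) (*-monoʳ-≤ (ones w C suc b) (C-monoˡ k (n≤1+n (zeros w))))

Sorted : Word → Set
Sorted w = w ≡ blocks₂ (ones w) (zeros w)

ones≡0⇒replicate : ∀ w → ones w ≡ 0 → w ≡ replicate (zeros w) false
ones≡0⇒replicate [] _ = refl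
ones≡0⇒replicate (false ∷ w) e = cong (false ∷_) (ones≡0⇒replicate w e)

-- An unsorted word loses at least the occurrences that straddle one adjacent pair 01.
Deficient : Word → Set
Deficient w = ∃[ o ] ∃[ z ] (ones w ≡ suc o × zeros w ≡ suc z ×
  (∀ b k → c (blocks₂ (suc b) (suc k)) w + (o C b) * (z C k) ≤ (suc o C suc b) * (suc z C suc k)))

-- Prepending a 1 to a deficient word preserves the loss, by Pascal's rule in o. For a leading 0
-- followed by some 1, no choice of ones that takes this 0 as well is an occurrence; these choices
-- already cover the required loss.
sorted-or-deficient : ∀ w → Sorted w ⊎ Deficient w
sorted-or-deficient [] = inj₁ refl
sorted-or-deficient (true ∷ w) with sorted-or-deficient w
... | inj₁ sorted = inj₁ (cong (true ∷_) sorted)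
... | inj₂ (o , z , o-eq , z-eq , bound) = inj₂ (suc o , z , cong suc o-eq , z-eq , bound′)
  where
  add : ∀ {x y p q t r s u v} r+ → t ≡ p + q → r+ ≡ r + s → x + p * u ≤ r * v → y + q * u ≤ s * v → x + y + t * u ≤ r+ * v
  add {x} {y} {p} {q} {_} {r} {s} {u} {v} _ refl refl l m =
    ≤-trans (≤-reflexive (regroup x y p q u)) (≤-trans (+-mono-≤ l m) (≤-reflexive (sym (*-distribʳ-+ v r s))))
    where
    regroup : ∀ x y p q u → x + y + (p + q) * u ≡ (x + p * u) + (y + q * u)
    regroup = solve-∀
  bound′ : ∀ b k → c (blocks₂ (suc b) (suc k)) (true ∷ w) + (suc o C b) * (z C k) ≤ (suc (suc o) C suc b) * (suc z C suc k)
  bound′ zero k = add {p = 0} {q = 1} {1} {r = 1} {s = suc o C 1} {u = z C k} {v = suc z C suc k} (suc (suc o) C 1) refl (pascal (suc o) 0)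
    (≤-reflexive (cong (_+ 0) (trans (c-zeros (suc k) w) (cong (_C suc k) z-eq)))) (bound 0 k)
  bound′ (suc b) k = add {p = o C b} {q = o C suc b} {suc o C suc b} {r = suc o C suc b} {s = suc o C suc (suc b)} {u = z C k} {v = suc z C suc k} (suc (suc o) C suc (suc b))
    (pascal o b) (pascal (suc o) (suc b)) (bound b k) (bound (suc b) k)
sorted-or-deficient (false ∷ w) with ones w in o-eq
... | zero = inj₁ (cong (false ∷_) (ones≡0⇒replicate w o-eq))
... | suc o = inj₂ (o , zeros w , refl , refl , bound)
  where
  bound : ∀ b k → c (blocks₂ (suc b) (suc k)) w + (o C b) * (zeros w C k) ≤ (suc o C suc b) * (suc (zeros w) C suc k)
  bound b k rewrite pascal (zeros w) k = begin
    c (blocks₂ (suc b) (suc k)) w + (o C b) * (zeros w C k)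
      ≤⟨ +-mono-≤ (subst (λ u → c (blocks₂ (suc b) (suc k)) w ≤ (u C suc b) * (zeros w C suc k)) o-eq (c-blocks₂-≤ (suc b) (suc k) w))
           (*-monoˡ-≤ (zeros w C k) (≤-trans (m≤m+n (o C b) (o C suc b)) (≤-reflexive (sym (pascal o b))))) ⟩
    (suc o C suc b) * (zeros w C suc k) + (suc o C suc b) * (zeros w C k)
      ≡⟨ trans (+-comm ((suc o C suc b) * (zeros w C suc k)) _) (sym (*-distribˡ-+ (suc o C suc b) (zeros w C k) (zeros w C suc k))) ⟩
    (suc o C suc b) * ((zeros w C k) + (zeros w C suc k)) ∎
    where open ≤-Reasoning

-- The count of 0^a 1^(b+1) 0^k in 0^i w, as a sum over the first letter 1 that is used.
offsetCount : ℕ → ℕ → ℕ → ℕ → Word → ℕ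
offsetCount a b k i [] = 0
offsetCount a b k i (false ∷ w) = offsetCount a b k (suc i) w
offsetCount a b k i (true ∷ w) = (i C a) * c (blocks₂ b k) w + offsetCount a b k i w

offsetCount-zero : ∀ b k i j w → offsetCount 0 b k i w ≡ offsetCount 0 b k j w
offsetCount-zero b k i j [] = refl
offsetCount-zero b k i j (false ∷ w) = offsetCount-zero b k (suc i) (suc j) w
offsetCount-zero b k i j (true ∷ w) = cong (1 * c (blocks₂ b k) w +_) (offsetCount-zero b k i j w)

offsetCount-suc : ∀ a b k i w → offsetCount (suc a) b k (suc i) w ≡ offsetCount a b k i w + offsetCount (suc a) b k i w
offsetCount-suc a b k i [] = refl
offsetCount-suc a b k i (false ∷ w) = offsetCount-suc a b k (suc i) w
offsetCount-suc a b k i (true ∷ w) =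
  trans (cong₂ _+_ (cong (_* x) (pascal i a)) (offsetCount-suc a b k i w))
    (regroup (i C a) (i C suc a) x (offsetCount a b k i w) (offsetCount (suc a) b k i w))
  where
  x = c (blocks₂ b k) w
  regroup : ∀ p q x u v → (p + q) * x + (u + v) ≡ (p * x + u) + (q * x + v)
  regroup = solve-∀

-- A leading 0 raises the offset from 0 to 1, and `offsetCount-suc` separates whether that 0 is
-- used.
c-blocks₃ : ∀ a b k w → c (blocks₃ a (suc b) k) w ≡ offsetCount a b k 0 w
c-blocks₃ zero b k [] = refl
c-blocks₃ (suc a) b k [] = refl
c-blocks₃ zero b k (true ∷ w) = cong₂ _+_ (sym (*-identityˡ _)) (c-blocks₃ zero b k w)
c-blocks₃ (suc a) b k (true ∷ w) = c-blocks₃ (suc a) b k w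
c-blocks₃ zero b k (false ∷ w) = trans (c-blocks₃ zero b k w) (offsetCount-zero b k 0 1 w)
c-blocks₃ (suc a) b k (false ∷ w) =
  trans (cong₂ _+_ (c-blocks₃ a b k w) (c-blocks₃ (suc a) b k w)) (sym (offsetCount-suc a b k 0 w))

zeros-replicate-false : ∀ z → zeros (replicate z false) ≡ z
zeros-replicate-false zero = refl
zeros-replicate-false (suc z) = cong suc (zeros-replicate-false z)

ones-replicate-false : ∀ z → ones (replicate z false) ≡ 0
ones-replicate-false zero = refl
ones-replicate-false (suc z) = ones-replicate-false z

zeros-blocks₂ : ∀ o z → zeros (blocks₂ o z) ≡ z
zeros-blocks₂ zero z = zeros-replicate-false z
zeros-blocks₂ (suc o) z = zeros-blocks₂ o z

ones-blocks₃ : ∀ s o z → ones (blocks₃ s o z) ≡ o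
ones-blocks₃ zero zero z = ones-replicate-false z
ones-blocks₃ zero (suc o) z = cong suc (ones-blocks₃ zero o z)
ones-blocks₃ (suc s) o z = ones-blocks₃ s o z

length-blocks₃ : ∀ s o z → length (blocks₃ s o z) ≡ s + o + z
length-blocks₃ zero zero z = length-replicate z {false}
length-blocks₃ zero (suc o) z = cong suc (length-blocks₃ zero o z)
length-blocks₃ (suc s) o z = cong suc (length-blocks₃ s o z)

c-blocks₂-blocks₂ : ∀ b k o z → c (blocks₂ b k) (blocks₂ o z) ≡ (o C b) * (z C k)
c-blocks₂-blocks₂ zero k o z = trans (c-zeros k (blocks₂ o z)) (trans (cong (_C k) (zeros-blocks₂ o z)) (sym (+-identityʳ _)))
c-blocks₂-blocks₂ (suc b) k zero z = none z
  where
  none : ∀ z → c (blocks₂ (suc b) k) (replicate z false) ≡ 0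
  none zero = refl
  none (suc z) = none z
c-blocks₂-blocks₂ (suc b) k (suc o) z = trans (cong₂ _+_ (c-blocks₂-blocks₂ b k o z) (c-blocks₂-blocks₂ (suc b) k o z))
  (trans (sym (*-distribʳ-+ (z C k) (o C b) (o C suc b))) (cong (_* (z C k)) (sym (pascal o b))))

c-blocks₂-blocks₃ : ∀ b k s o z → c (blocks₂ (suc b) k) (blocks₃ s o z) ≡ (o C suc b) * (z C k)
c-blocks₂-blocks₃ b k zero o z = c-blocks₂-blocks₂ (suc b) k o z
c-blocks₂-blocks₃ b k (suc s) o z = c-blocks₂-blocks₃ b k s o z

offsetCount-blocks₂ : ∀ a b k i o z → offsetCount a b k i (blocks₂ o z) ≡ weight a (suc b) k i o z
offsetCount-blocks₂ a b k i zero z = trans (none i z) (sym (cong (_* (z C k)) (*-zeroʳ (i C a))))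
  where
  none : ∀ i z → offsetCount a b k i (replicate z false) ≡ 0
  none i zero = refl
  none i (suc z) = none (suc i) z
offsetCount-blocks₂ a b k i (suc o) z = trans (cong₂ _+_ (cong ((i C a) *_) (c-blocks₂-blocks₂ b k o z)) (offsetCount-blocks₂ a b k i o z))
  (trans (regroup (i C a) (o C b) (o C suc b) (z C k)) (cong (λ u → (i C a) * u * (z C k)) (sym (pascal o b))))
  where
  regroup : ∀ p q r s → p * (q * s) + p * r * s ≡ p * (q + r) * s
  regroup = solve-∀

c-blocks₃-blocks₃ : ∀ a b k s o z → c (blocks₃ a (suc b) k) (blocks₃ s o z) ≡ weight a (suc b) k s o z
c-blocks₃-blocks₃ a b k s o z = trans (c-blocks₃ a b k (blocks₃ s o z))
  (trans (skip 0 s) (cong (λ i → weight a (suc b) k i o z) (+-identityʳ s)))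
  where
  skip : ∀ i s → offsetCount a b k i (blocks₃ s o z) ≡ weight a (suc b) k (s + i) o z
  skip i zero = offsetCount-blocks₂ a b k i o z
  skip i (suc s) = trans (skip (suc i) s) (cong (λ j → weight a (suc b) k j o z) (+-suc s i))

-- l and l′ are the numbers of zeros before and after a letter 1, or a block of them.
IsLevelBound : ℕ → ℕ → ℕ → ℕ → Set
IsLevelBound a k m H = ∀ l l′ → l + l′ ≡ m → (l C a) * (l′ C k) ≤ H

level-argmax : ∀ (f : ℕ → ℕ → ℕ) m → ∃[ l ] ∃[ l′ ] (l + l′ ≡ m × (∀ i j → i + j ≡ m → f i j ≤ f l l′))
level-argmax f zero = 0 , 0 , refl , λ { zero zero _ → ≤-refl }
level-argmax f (suc m) with level-argmax (λ i j → f (suc i) j) m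
... | l , l′ , eq , max with ≤-total (f 0 (suc m)) (f (suc l) l′)
... | inj₁ le = suc l , l′ , cong suc eq , λ { zero j refl → le ; (suc i) j e → max i j (suc-injective e) }
... | inj₂ ge = 0 , suc m , refl , λ { zero j refl → ≤-refl ; (suc i) j e → ≤-trans (max i j (suc-injective e)) ge }

module _ (a b k : ℕ) where

  first-term-≤ : ∀ {i H} w → IsLevelBound a k (i + zeros w) H → (i C a) * c (blocks₂ b k) w ≤ (ones w C b) * H
  first-term-≤ {i} {H} w bound = begin
    (i C a) * c (blocks₂ b k) w                 ≤⟨ *-monoʳ-≤ (i C a) (c-blocks₂-≤ b k w) ⟩
    (i C a) * ((ones w C b) * (zeros w C k))    ≡⟨ regroup (i C a) (ones w C b) (zeros w C k) ⟩
    (ones w C b) * ((i C a) * (zeros w C k))    ≤⟨ *-monoʳ-≤ (ones w C b) (bound i (zeros w) refl) ⟩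
    (ones w C b) * H ∎
    where
    open ≤-Reasoning
    regroup : ∀ p q r → p * (q * r) ≡ q * (p * r)
    regroup = solve-∀

  -- Each 1 contributes at most H times the number of ways to choose the other b ones behind it. By
  -- Pascal's rule these numbers add up to C(ones w, b+1).
  offsetCount-≤ : ∀ {i H} w → IsLevelBound a k (i + zeros w) H → offsetCount a b k i w ≤ (ones w C suc b) * H
  offsetCount-≤ [] bound = z≤n
  offsetCount-≤ {i} {H} (false ∷ w) bound = offsetCount-≤ w (subst (λ m → IsLevelBound a k m H) (+-suc i (zeros w)) bound)
  offsetCount-≤ {i} {H} (true ∷ w) bound = ≤-trans (+-mono-≤ (first-term-≤ w bound) (offsetCount-≤ w bound))
    (≤-reflexive (trans (sym (*-distribʳ-+ H (ones w C b) (ones w C suc b))) (cong (_* H) (sym (pascal (ones w) b)))))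

-- Words whose count reaches the level bound or misses it by one

pos-factors : ∀ x {y} → 1 ≤ x * y → 1 ≤ x × 1 ≤ y
pos-factors (suc x) {zero} pos = contradiction (subst (1 ≤_) (*-zeroʳ x) pos) λ ()
pos-factors (suc x) {suc y} _ = s≤s z≤n , s≤s z≤n

split-tight : ∀ {x y x̂ ŷ} → x ≤ x̂ → y ≤ ŷ → x + y ≡ x̂ + ŷ → x ≡ x̂ × y ≡ ŷ
split-tight {x} {y} {x̂} {ŷ} x≤ y≤ eq = x≡ , +-cancelˡ-≡ x y ŷ (trans eq (cong (_+ ŷ) (sym x≡)))
  where
  x≡ : x ≡ x̂
  x≡ = ≤-antisym x≤ (+-cancelʳ-≤ ŷ x̂ x (≤-trans (≤-reflexive (sym eq)) (+-monoʳ-≤ x y≤)))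

split-deficit : ∀ {x y x̂ ŷ} → x ≤ x̂ → y ≤ ŷ → suc (x + y) ≡ x̂ + ŷ → (x ≡ x̂ × suc y ≡ ŷ) ⊎ (suc x ≡ x̂ × y ≡ ŷ)
split-deficit {x} {y} {x̂} {ŷ} x≤ y≤ eq with m≤n⇒m<n∨m≡n x≤
... | inj₁ x< = inj₂ (split-tight x< y≤ eq)
... | inj₂ refl = inj₁ (refl , +-cancelˡ-≡ x (suc y) ŷ (trans (+-suc x y) eq))

Blocks : Word → Set
Blocks w = ∃[ s ] ∃[ o ] ∃[ z ] w ≡ blocks₃ s o z

cons-false : ∀ {w} → Blocks w → Blocks (false ∷ w)
cons-false (s , o , z , eq) = suc s , o , z , cong (false ∷_) eq

cons-true : ∀ {w} → Sorted w → Blocks (true ∷ w)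
cons-true {w} sorted = 0 , suc (ones w) , zeros w , cong (true ∷_) sorted

module _ (a b k : ℕ) where

  private
    count : ℕ → Word → ℕ
    count = offsetCount (suc a) (suc b) (suc k)

  deficient-loss : ∀ {i H} w → ((o , z , _) : Deficient w) → IsLevelBound (suc a) (suc k) (i + zeros w) H →
    (i C suc a) * c (blocks₂ (suc b) (suc k)) w + (i C suc a) * ((o C b) * (z C k)) ≤ (ones w C suc b) * H
  deficient-loss {i} {H} w (o , z , o-eq , z-eq , loss) bound = begin
    p * x + p * e                                     ≡⟨ *-distribˡ-+ p x e ⟨
    p * (x + e)                                       ≤⟨ *-monoʳ-≤ p (loss b k) ⟩
    p * ((suc o C suc b) * (suc z C suc k))           ≡⟨ cong₂ (λ u v → p * ((u C suc b) * (v C suc k))) o-eq z-eq ⟨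
    p * ((ones w C suc b) * (zeros w C suc k))        ≡⟨ regroup p (ones w C suc b) (zeros w C suc k) ⟩
    (ones w C suc b) * (p * (zeros w C suc k))        ≤⟨ *-monoʳ-≤ (ones w C suc b) (bound i (zeros w) refl) ⟩
    (ones w C suc b) * H                              ∎
    where
    open ≤-Reasoning
    p = i C suc a
    x = c (blocks₂ (suc b) (suc k)) w
    e = (o C b) * (z C k)
    regroup : ∀ p q r → p * (q * r) ≡ q * (p * r)
    regroup = solve-∀

  deficient-gap-pos : ∀ w → ((o , z , _) : Deficient w) → suc b ≤ ones w → 1 ≤ c (blocks₂ (suc b) (suc k)) w →
    1 ≤ (o C b) × 1 ≤ (z C k)
  deficient-gap-pos w (o , z , o-eq , z-eq , _) b<o x-pos =
      C-pos (≤-pred (subst (suc b ≤_) o-eq b<o))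
    , C-pos (≤-pred (subst (suc k ≤_) z-eq (C-pos⁻¹ (proj₂ (pos-factors (ones w C suc b) (≤-trans x-pos (c-blocks₂-≤ (suc b) (suc k) w)))))))

  -- For an unsorted `w` the loss C(i,a+1) C(o,b) C(z,k) of `deficient-loss` is positive, and
  -- tightness leaves no room for it.
  first-term-tight : ∀ {i H} w → 1 ≤ H → suc b ≤ ones w → IsLevelBound (suc a) (suc k) (i + zeros w) H →
    (i C suc a) * c (blocks₂ (suc b) (suc k)) w ≡ (ones w C suc b) * H → Sorted w
  first-term-tight {i} {H} w H-pos b<o bound tight with sorted-or-deficient w
  ... | inj₁ sorted = sorted
  ... | inj₂ def@(o , z , _) = contradiction nothing (<⇒≱ something)
    where
    p = i C suc a
    x = c (blocks₂ (suc b) (suc k)) w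
    p,x-pos : 1 ≤ p × 1 ≤ x
    p,x-pos = pos-factors p (≤-trans (*-mono-≤ (C-pos b<o) H-pos) (≤-reflexive (sym tight)))
    something : 1 ≤ p * ((o C b) * (z C k))
    something = let (q , r) = deficient-gap-pos w def b<o (proj₂ p,x-pos) in *-mono-≤ (proj₁ p,x-pos) (*-mono-≤ q r)
    nothing : p * ((o C b) * (z C k)) ≤ 0
    nothing = +-cancelˡ-≤ (p * x) _ _ (≤-trans (deficient-loss w def bound)
      (≤-reflexive (trans (sym tight) (sym (+-identityʳ (p * x))))))

  pascal-* : ∀ o H → (suc o C suc (suc b)) * H ≡ (o C suc b) * H + (o C suc (suc b)) * H
  pascal-* o H = trans (cong (_* H) (pascal o (suc b))) (*-distribʳ-+ H (o C suc b) (o C suc (suc b)))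

  count-tight : ∀ {i H} w → 1 ≤ H → suc (suc b) ≤ ones w → IsLevelBound (suc a) (suc k) (i + zeros w) H →
    count i w ≡ (ones w C suc (suc b)) * H → Blocks w
  count-tight {i} {H} (false ∷ w) H-pos large bound tight =
    cons-false (count-tight w H-pos large (subst (λ m → IsLevelBound (suc a) (suc k) m H) (+-suc i (zeros w)) bound) tight)
  count-tight {i} {H} (true ∷ w) H-pos (s≤s large) bound tight =
    cons-true (first-term-tight {i} {H} w H-pos large bound
      (proj₁ (split-tight (first-term-≤ (suc a) (suc b) (suc k) w bound) (offsetCount-≤ (suc a) (suc b) (suc k) w bound)
        (trans tight (pascal-* (ones w) H)))))

  -- The pattern uses all remaining ones, so o = b. A deficit of 1 bounds the loss by 1, which gives
  -- p = 1, that is i = a + 1, and x ≤ y. The level with one more zero in front has value (a+2) y ≥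
  -- 2x, yet at most H = x + 1. So x ≤ 1, against H ≥ 3.
  single-block-absurd : ∀ {i H} w → Deficient w → suc b ≡ ones w → 3 ≤ H → IsLevelBound (suc a) (suc k) (i + zeros w) H →
    suc ((i C suc a) * c (blocks₂ (suc b) (suc k)) w) ≢ H
  single-block-absurd {i} {H} w def@(o , z , o-eq , z-eq , loss) b+1≡o (s≤s two) bound refl =
    contradiction x≤1 (<⇒≱ (≤-trans two (≤-reflexive (trans (cong (_* x) p≡1) (*-identityˡ x)))))
    where
    p = i C suc a
    x = c (blocks₂ (suc b) (suc k)) w
    y = z C suc k
    o≡b : o ≡ b
    o≡b = suc-injective (trans (sym o-eq) (sym b+1≡o))
    p,x-pos : 1 ≤ p × 1 ≤ x
    p,x-pos = pos-factors p (≤-trans (s≤s z≤n) two)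
    gaps = deficient-gap-pos w def (≤-reflexive b+1≡o) (proj₂ p,x-pos)
    p≤1 : p ≤ 1
    p≤1 = ≤-trans (≤-trans (≤-reflexive (sym (*-identityʳ p))) (*-monoʳ-≤ p (*-mono-≤ (proj₁ gaps) (proj₂ gaps))))
      (+-cancelˡ-≤ (p * x) _ _ (≤-trans (deficient-loss w def bound)
        (≤-reflexive (trans (cong (λ u → (u C suc b) * suc (p * x)) (sym b+1≡o)) (trans (cong (_* suc (p * x)) (nCn≡1 (suc b)))
          (trans (*-identityˡ _) (+-comm 1 (p * x))))))))
    p≡1 : p ≡ 1
    p≡1 = ≤-antisym p≤1 (proj₁ p,x-pos)
    x≤y : x ≤ y
    x≤y = +-cancelʳ-≤ (z C k) x y (subst₂ _≤_
      (cong (x +_) (trans (cong (λ u → (u C b) * (z C k)) o≡b) (trans (cong (_* (z C k)) (nCn≡1 b)) (*-identityˡ _))))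
      (trans (cong (λ u → (suc u C suc b) * (suc z C suc k)) o≡b) (trans (cong (_* (suc z C suc k)) (nCn≡1 (suc b)))
        (trans (*-identityˡ _) (trans (pascal z k) (+-comm (z C k) y)))))
      (loss b k))
    double : 2 * x ≤ suc x
    double = begin
      2 * x                      ≤⟨ *-mono-≤ {2} {suc (suc a)} (s≤s (s≤s z≤n)) x≤y ⟩
      suc (suc a) * y            ≡⟨ cong (_* y) ([1+k]Ck≡1+k (suc a)) ⟨
      (suc (suc a) C suc a) * y  ≡⟨ cong (λ u → (suc u C suc a) * y) (nCk≡1⇒n≡k {i} {suc a} (s≤s z≤n) p≡1) ⟨
      (suc i C suc a) * y        ≤⟨ bound (suc i) z (trans (sym (+-suc i z)) (cong (i +_) (sym z-eq))) ⟩
      suc (p * x)                ≡⟨ cong suc (trans (cong (_* x) p≡1) (*-identityˡ x)) ⟩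
      suc x                      ∎
      where open ≤-Reasoning
    x≤1 : x ≤ 1
    x≤1 = +-cancelˡ-≤ x x 1 (≤-trans (≤-reflexive (cong (x +_) (sym (+-identityʳ x)))) (≤-trans double (≤-reflexive (+-comm 1 x))))

  -- Either the term of the first 1 is tight, and then the ones form one block, or the missing unit
  -- lies in that term and all later terms are tight. In the second case more than b+1 remaining
  -- ones contradict divisibility, and exactly b+1 leave only the sorted remainder.
  count-deficit-one : ∀ {i H} w → 3 ≤ (ones w C suc (suc b)) * H → IsLevelBound (suc a) (suc k) (i + zeros w) H →
    suc (count i w) ≡ (ones w C suc (suc b)) * H → Blocks w
  count-deficit-one {i} {H} (false ∷ w) big bound deficit =
    cons-false (count-deficit-one w big (subst (λ m → IsLevelBound (suc a) (suc k) m H) (+-suc i (zeros w)) bound) deficit)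
  count-deficit-one {i} {H} (true ∷ w) big bound deficit
    with pos-factors (suc (ones w) C suc (suc b)) (≤-trans (s≤s z≤n) big)
  ... | C>0 , H-pos with C-pos⁻¹ {suc (ones w)} {suc (suc b)} C>0
  ... | s≤s b<o with split-deficit (first-term-≤ (suc a) (suc b) (suc k) w bound) (offsetCount-≤ (suc a) (suc b) (suc k) w bound)
                      (trans deficit (pascal-* (ones w) H))
  ... | inj₁ (tight , _) = cons-true (first-term-tight {i} {H} w H-pos b<o bound tight)
  ... | inj₂ (first-deficit , tight) with m≤n⇒m<n∨m≡n b<o
  -- All other terms are tight, so C(o, b+1) > 1 divides both the first term and its bound.
  ... | inj₁ b+1<o with count-tight w H-pos b+1<o bound tight
  ... | s , o , z , refl = contradiction (k<n⇒k<nCk {ones w} {suc b} b+1<o) (<⇒≱ (s≤s (≤-trans (≤-reflexive unit) (s≤s z≤n))))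
    where
    q = ones (blocks₃ s o z) C suc b
    p = i C suc a
    t = z C suc k
    value : p * c (blocks₂ (suc b) (suc k)) (blocks₃ s o z) ≡ p * t * q
    value = trans (cong (p *_) (trans (c-blocks₂-blocks₃ b (suc k) s o z) (cong (λ u → (u C suc b) * t) (sym (ones-blocks₃ s o z))))) (regroup p q t)
      where
      regroup : ∀ p q t → p * (q * t) ≡ p * t * q
      regroup = solve-∀
    unit : q ≡ 1
    unit = proj₁ (unit-difference {p * t} {H} {q} (trans (cong suc (sym value)) (trans first-deficit (*-comm q H))))
  count-deficit-one {i} {H} (true ∷ w) big bound deficit | _ , H-pos | s≤s b<o | inj₂ (first-deficit , tight) | inj₂ b+1≡o
    with sorted-or-deficient w
  ... | inj₁ sorted = cons-true sorted
  ... | inj₂ def = ⊥-elim (single-block-absurd w def b+1≡o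
      (≤-trans big (≤-reflexive (trans (cong (λ o → (suc o C suc (suc b)) * H) (sym b+1≡o)) (trans (cong (_* H) (nCn≡1 (suc (suc b)))) (*-identityˡ H)))))
      bound (trans first-deficit (trans (cong (λ o → (o C suc b) * H) (sym b+1≡o)) (trans (cong (_* H) (nCn≡1 (suc b))) (*-identityˡ H)))))

-- With a single 1 in the pattern each 1 of the word contributes the product at its own level. A
-- total deficit of 1 therefore falls on one 1, whose level has value H-1.
single-one-deficit : ∀ a k {i H} w → IsLevelBound a k (i + zeros w) H → suc (offsetCount a 0 k i w) ≡ (ones w C 1) * H →
  ∃[ l ] ∃[ l′ ] (l + l′ ≡ i + zeros w × suc ((l C a) * (l′ C k)) ≡ H)
single-one-deficit a k {i} {H} (false ∷ w) bound deficit
  with single-one-deficit a k w (subst (λ m → IsLevelBound a k m H) (+-suc i (zeros w)) bound) deficit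
... | l , l′ , sum , eq = l , l′ , trans sum (sym (+-suc i (zeros w))) , eq
single-one-deficit a k {i} {H} (true ∷ w) bound deficit
  with split-deficit (first-term-≤ a 0 k w bound) (offsetCount-≤ a 0 k w bound)
         (trans deficit (trans (cong (_* H) (pascal (ones w) 0)) (*-distribʳ-+ H 1 (ones w C 1))))
... | inj₁ (_ , rest) = single-one-deficit a k w bound rest
... | inj₂ (first , _) = i , zeros w , refl ,
  trans (cong (λ u → suc ((i C a) * u)) (sym (c-zeros k w))) (trans first (*-identityˡ H))

-- The gap below the maximum for non-alternating words

-- The maximum enters as any upper bound `m` that some word attains, so that the property passes
-- directly to complemented words. The bound `3 ≤ m` also places m-1 strictly above the count 0.
Gap : Word → ℕ → Set
Gap p n = ∀ {m} → (∀ w → length w ≡ n → c p w ≤ m) → ∀ w₀ → length w₀ ≡ n → c p w₀ ≡ m →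
  3 ≤ m × (∀ w → length w ≡ n → suc (c p w) ≢ m)

-- The count depends only on the number of zeros. The maximum belongs to the constant word, and
-- losing one zero already costs C(n,a+1) ≥ 2, where the length is n + 1.
gap₁ : ∀ a {n} → suc (suc a) + 3 ≤ n → Gap (replicate (suc (suc a)) false) n
gap₁ a {suc n} large {m} bound w₀ len₀ max = 3≤m , λ w len below → no-below w len (trans below m≡)
  where
  A = suc (suc a)
  room : suc A ≤ n
  room = ≤-pred (≤-trans (s≤s (≤-trans (≤-reflexive (+-comm 1 A)) (+-monoʳ-≤ A (s≤s z≤n)))) (≤-trans (≤-reflexive (sym (+-suc A 2))) large))
  value : c (replicate A false) (replicate (suc n) false) ≡ suc n C A
  value = trans (c-zeros A (replicate (suc n) false)) (cong (_C A) (zeros-replicate-false (suc n)))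
  m≡ : m ≡ suc n C A
  m≡ = ≤-antisym
    (≤-trans (≤-reflexive (trans (sym max) (c-zeros A w₀))) (C-monoˡ A (≤-trans (m≤n+m (zeros w₀) (ones w₀)) (≤-reflexive (trans (ones+zeros w₀) len₀)))))
    (≤-trans (≤-reflexive (sym value)) (bound (replicate (suc n) false) (length-replicate (suc n))))
  3≤m : 3 ≤ m
  3≤m = ≤-trans (≤-trans (s≤s (s≤s (s≤s z≤n))) (1+k<n⇒1+k<nCk {suc n} {A} (s≤s z≤n) (s≤s room))) (≤-reflexive (sym m≡))
  2≤C : 2 ≤ n C suc a
  2≤C = ≤-trans (s≤s (s≤s z≤n)) (k<n⇒k<nCk {n} {suc a} (<⇒≤ room))
  no-below : ∀ w → length w ≡ suc n → suc (c (replicate A false) w) ≢ suc n C A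
  no-below w len below with m≤n⇒m<n∨m≡n (≤-trans (m≤n+m (zeros w) (ones w)) (≤-reflexive (trans (ones+zeros w) len)))
  ... | inj₂ eq = 1+n≢n (trans (trans (cong (λ z → suc (z C A)) (sym eq)) (cong suc (sym (c-zeros A w)))) below)
  ... | inj₁ (s≤s z≤n′) = contradiction (+-cancelʳ-≤ (n C A) 2 1 (begin
      2 + (n C A)                 ≤⟨ +-monoˡ-≤ (n C A) 2≤C ⟩
      (n C suc a) + (n C A)       ≡⟨ pascal n (suc a) ⟨
      suc n C A                   ≡⟨ below ⟨
      suc (c (replicate A false) w) ≡⟨ cong suc (c-zeros A w) ⟩
      suc (zeros w C A)           ≤⟨ s≤s (C-monoˡ A z≤n′) ⟩
      1 + (n C A)                 ∎)) λ where (s≤s ())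
    where open ≤-Reasoning

unit-factors : ∀ {x y} → 1 ≤ x → 1 ≤ y → x * y ≤ 1 → x ≡ 1 × y ≡ 1
unit-factors {x} {y} x-pos y-pos le =
    ≤-antisym (≤-trans (≤-trans (≤-reflexive (sym (*-identityʳ x))) (*-monoʳ-≤ x y-pos)) le) x-pos
  , ≤-antisym (≤-trans (≤-trans (≤-reflexive (sym (*-identityˡ y))) (*-monoˡ-≤ y x-pos)) le) y-pos

one-part-absurd : ∀ o k → 4 ≤ suc o → ¬ o * suc (suc (suc k)) ≤ suc o
one-part-absurd o k (s≤s large) le = contradiction
  (+-cancelˡ-≤ o (o * 2) 1 (≤-trans (≤-reflexive (sym (*-suc o 2))) (≤-trans (*-monoʳ-≤ o {3} (s≤s (s≤s (s≤s z≤n)))) (≤-trans le (≤-reflexive (+-comm 1 o))))))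
  (<⇒≱ (≤-trans (s≤s (s≤s z≤n)) (*-monoˡ-≤ 2 large)))

-- If the count equals the product of binomials, `no-product-below-max` applies. Otherwise that
-- product is m and `w` is unsorted with loss C(o,b) C(z,k) ≤ 1, so both coefficients are 1.
gap₂ : ∀ b k {n} → ¬ (b ≡ 0 × k ≡ 0) → suc b + suc k + 3 ≤ n → Gap (blocks₂ (suc b) (suc k)) n
gap₂ b k {n} nontrivial large {m} bound w₀ len₀ max = 3≤m , no-below
  where
  B′ = suc b
  K′ = suc k
  split : ∀ w → length w ≡ n → ones w + zeros w ≡ n
  split w len = trans (ones+zeros w) len
  bound₂ : ∀ i j → i + j ≡ n → (i C B′) * (j C K′) ≤ m
  bound₂ i j e = ≤-trans (≤-reflexive (sym (c-blocks₂-blocks₂ B′ K′ i j))) (bound (blocks₂ i j) (trans (length-blocks₃ 0 i j) e))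
  max₂ : (ones w₀ C B′) * (zeros w₀ C K′) ≡ m
  max₂ = ≤-antisym (bound₂ (ones w₀) (zeros w₀) (split w₀ len₀)) (≤-trans (≤-reflexive (sym max)) (c-blocks₂-≤ B′ K′ w₀))
  3≤m : 3 ≤ m
  3≤m with m≤n⇒∃[o]m+o≡n large
  ... | d , refl = ≤-trans
    (≤-trans (s≤s (s≤s (s≤s z≤n))) (1+k<n⇒1+k<nCk {B′ + 2 + d} {B′} (s≤s z≤n) (≤-trans (≤-reflexive (+-comm 2 B′)) (m≤m+n (B′ + 2) d))))
    (≤-trans (≤-reflexive (sym (*-identityʳ _)))
      (≤-trans (*-monoʳ-≤ ((B′ + 2 + d) C B′) (C-pos {suc K′} {K′} (n≤1+n K′))) (bound₂ (B′ + 2 + d) (suc K′) (sum b k d))))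
    where
    sum : ∀ b k d → suc b + 2 + d + suc (suc k) ≡ suc b + suc k + 3 + d
    sum = solve-∀
  no-below : ∀ w → length w ≡ n → suc (c (blocks₂ B′ K′) w) ≢ m
  no-below w len below with m≤n⇒m<n∨m≡n (c-blocks₂-≤ B′ K′ w)
  ... | inj₂ eq = no-product-below-max b k nontrivial (≤-trans (+-monoʳ-≤ (suc b + suc k) (n≤1+n 2)) large) bound₂
        (ones w₀) (zeros w₀) (split w₀ len₀) max₂ (ones w) (zeros w) (split w len) (trans (cong suc (sym eq)) below)
  ... | inj₁ lt with sorted-or-deficient w
  ... | inj₁ sorted = <-irrefl (trans (cong (c (blocks₂ B′ K′)) sorted) (c-blocks₂-blocks₂ B′ K′ (ones w) (zeros w))) lt
  ... | inj₂ (o , z , o-eq , z-eq , loss) = absurd o z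
        (trans (sym (cong₂ _+_ o-eq z-eq)) (split w len))
        (≤-antisym (bound₂ (suc o) (suc z) (trans (sym (cong₂ _+_ o-eq z-eq)) (split w len)))
          (≤-trans (≤-reflexive (sym below)) (subst₂ (λ u v → suc (c (blocks₂ B′ K′) w) ≤ (u C B′) * (v C K′)) o-eq z-eq lt)))
        (+-cancelˡ-≤ (c (blocks₂ B′ K′) w) _ _ (≤-trans (loss b k) (≤-trans (bound₂ (suc o) (suc z) (trans (sym (cong₂ _+_ o-eq z-eq)) (split w len)))
          (≤-reflexive (trans (sym below) (+-comm 1 _))))))
    where
    absurd : ∀ o z → suc o + suc z ≡ n → (suc o C B′) * (suc z C K′) ≡ m → ¬ (o C b) * (z C k) ≤ 1
    absurd o z sum value small with pos-factors (suc o C B′) (subst (1 ≤_) (sym value) (≤-trans (s≤s z≤n) 3≤m))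
    ... | o-pos , z-pos
      with unit-factors {o C b} {z C k} (C-pos (≤-pred (C-pos⁻¹ {suc o} {B′} o-pos))) (C-pos (≤-pred (C-pos⁻¹ {suc z} {K′} z-pos))) small
    ... | o≡1 , z≡1 = cases b k o z nontrivial (subst (suc b + suc k + 3 ≤_) (sym sum) large) o≡1 z≡1
      (≤-trans (bound₂ o (suc (suc z)) (trans (+-suc o (suc z)) sum)) (≤-reflexive (sym value)))
      (≤-trans (bound₂ (suc (suc o)) z (trans (sym (cong suc (+-suc o z))) sum)) (≤-reflexive (sym value)))
      where
      -- If b, k ≥ 1, then o = b and z = k, which is too short. If exactly one exponent is 1, the
      -- letter of the other run occurs exactly as often as its exponent, and one more copy of it in
      -- place of the first letter gives a larger product.
      cases : ∀ b k o z → ¬ (b ≡ 0 × k ≡ 0) → suc b + suc k + 3 ≤ suc o + suc z → o C b ≡ 1 → z C k ≡ 1 →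
        (o C suc b) * (suc (suc z) C suc k) ≤ (suc o C suc b) * (suc z C suc k) →
        (suc (suc o) C suc b) * (z C suc k) ≤ (suc o C suc b) * (suc z C suc k) → ⊥
      cases zero zero o z nontrivial _ _ _ _ _ = nontrivial (refl , refl)
      cases (suc b) (suc k) o z _ large o≡1 z≡1 _ _ with nCk≡1⇒n≡k {o} {suc b} (s≤s z≤n) o≡1 | nCk≡1⇒n≡k {z} {suc k} (s≤s z≤n) z≡1
      ... | refl | refl = m+1+n≰m _ large
      cases zero (suc k) o z _ large _ z≡1 le _ with nCk≡1⇒n≡k {z} {suc k} (s≤s z≤n) z≡1
      ... | refl = contradiction (subst₂ _≤_
              (cong₂ _*_ (nC1≡n o) ([1+k]Ck≡1+k (suc (suc k))))
              (trans (cong₂ _*_ (nC1≡n (suc o)) (nCn≡1 (suc (suc k)))) (*-identityʳ (suc o))) le)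
              (one-part-absurd o k (+-cancelʳ-≤ (suc (suc k)) 4 (suc o) (≤-trans (≤-reflexive (+-comm 4 _)) (≤-trans (≤-reflexive (shift k)) large))))
        where
        shift : ∀ k → suc (suc k) + 4 ≡ 1 + suc (suc k) + 3
        shift = solve-∀
      cases (suc b) zero o z _ large o≡1 _ _ le with nCk≡1⇒n≡k {o} {suc b} (s≤s z≤n) o≡1
      ... | refl = contradiction (subst₂ _≤_
              (trans (cong₂ _*_ ([1+k]Ck≡1+k (suc (suc b))) (nC1≡n z)) (*-comm _ z))
              (trans (cong₂ _*_ (nCn≡1 (suc (suc b))) (nC1≡n (suc z))) (*-identityˡ (suc z))) le)
              (one-part-absurd z b (+-cancelˡ-≤ (suc (suc b)) 4 (suc z) (≤-trans (≤-reflexive (sym (+-assoc (suc (suc b)) 1 3))) large)))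

-- For a block of zeros as long as its exponent x + 1, trading one of r + 1 ones for a zero there
-- changes the factor from r + 1 to (x+2) r, an increase when r ≥ 2.
extra-zero-better : ∀ x r {y} → 1 ≤ y → 2 ≤ r → ¬ suc (suc x) * r * y ≤ suc r * y
extra-zero-better x r {suc y} _ 2≤r le = contradiction
  (+-cancelˡ-≤ r r 1 (≤-trans (+-monoʳ-≤ r (m≤m+n r (x * r))) (≤-trans (*-cancelʳ-≤ (suc (suc x) * r) (suc r) (suc y) le) (≤-reflexive (+-comm 1 r)))))
  (<⇒≱ 2≤r)

-- Either the count equals its envelope, a weight, and `no-weight-below-max` applies, or the
-- envelope is m and the word misses it by one. Then b ≥ 1 makes the word a block word, whose count
-- is again a weight; b = 0 is treated through the levels.
gap₃ : ∀ a b k {n} → ¬ (a ≡ 0 × b ≡ 0 × k ≡ 0) → suc a + suc b + suc k + 3 ≤ n → Gap (blocks₃ (suc a) (suc b) (suc k)) n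
gap₃ a b k {n} nontrivial large {m} bound w₀ len₀ max = 3≤m , no-below
  where
  A = suc a
  B′ = suc b
  K′ = suc k
  p = blocks₃ A B′ K′
  bound₃ : IsBound A B′ K′ n m
  bound₃ s o z e = ≤-trans (≤-reflexive (sym (c-blocks₃-blocks₃ A b K′ s o z))) (bound (blocks₃ s o z) (trans (length-blocks₃ s o z) e))
  3≤m : 3 ≤ m
  3≤m with m≤n⇒∃[o]m+o≡n large
  ... | d , refl = begin
    3                              ≤⟨ s≤s (s≤s (s≤s z≤n)) ⟩
    suc (suc A)                    ≤⟨ 1+k<n⇒1+k<nCk {A + 3 + d} {A} (s≤s z≤n) (≤-trans (≤-trans (≤-reflexive (+-comm 2 A)) (+-monoʳ-≤ A (n≤1+n 2))) (m≤m+n (A + 3) d)) ⟩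
    (A + 3 + d) C A                ≡⟨ trans (cong₂ (λ u v → ((A + 3 + d) C A) * u * v) (nCn≡1 B′) (nCn≡1 K′)) (trans (*-identityʳ _) (*-identityʳ _)) ⟨
    weight A B′ K′ (A + 3 + d) B′ K′ ≤⟨ bound₃ (A + 3 + d) B′ K′ (sum a b k d) ⟩
    m                              ∎
    where
    open ≤-Reasoning
    sum : ∀ a b k d → suc a + 3 + d + suc b + suc k ≡ suc a + suc b + suc k + 3 + d
    sum = solve-∀
  -- The best word with given numbers of letters puts all its ones at a single level.
  envelope : ∀ w → length w ≡ n → ∃[ l ] ∃[ l′ ] (l + l′ ≡ zeros w ×
    IsLevelBound A K′ (zeros w) ((l C A) * (l′ C K′)) × l + ones w + l′ ≡ n ×
    weight A B′ K′ l (ones w) l′ ≡ (ones w C B′) * ((l C A) * (l′ C K′)))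
  envelope w len with level-argmax (λ i j → (i C A) * (j C K′)) (zeros w)
  ... | l , l′ , sum , best = l , l′ , sum , best ,
    trans (perm l (ones w) l′) (trans (cong (ones w +_) sum) (trans (ones+zeros w) len)) ,
    regroup (l C A) (ones w C B′) (l′ C K′)
    where
    perm : ∀ l o l′ → l + o + l′ ≡ o + (l + l′)
    perm = solve-∀
    regroup : ∀ x y z → x * y * z ≡ y * (x * z)
    regroup = solve-∀
  count≤ : ∀ w {H} → IsLevelBound A K′ (zeros w) H → c p w ≤ (ones w C B′) * H
  count≤ w level = ≤-trans (≤-reflexive (c-blocks₃ A b K′ w)) (offsetCount-≤ A b K′ w level)
  no-composition-below : ∀ s o z → s + o + z ≡ n → suc (weight A B′ K′ s o z) ≢ m
  no-composition-below with envelope w₀ len₀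
  ... | l , l′ , _ , level , sum , value = no-weight-below-max a b k nontrivial large bound₃ l (ones w₀) l′ sum
    (≤-antisym (bound₃ l (ones w₀) l′ sum) (≤-trans (≤-reflexive (sym max)) (≤-trans (count≤ w₀ level) (≤-reflexive (sym value)))))
  no-below : ∀ w → length w ≡ n → suc (c p w) ≢ m
  no-below w len below with envelope w len
  ... | l , l′ , l+l′ , level , sum , value with m≤n⇒m<n∨m≡n (count≤ w level)
  ... | inj₂ eq = no-composition-below l (ones w) l′ sum (trans (cong suc (trans value (sym eq))) below)
  ... | inj₁ lt = deficit-one b refl
    where
    H = (l C A) * (l′ C K′)
    H-total : (ones w C B′) * H ≡ m
    H-total = ≤-antisym (≤-trans (≤-reflexive (sym value)) (bound₃ l (ones w) l′ sum)) (≤-trans (≤-reflexive (sym below)) lt)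
    deficit : suc (offsetCount A b K′ 0 w) ≡ (ones w C B′) * H
    deficit = trans (cong suc (sym (c-blocks₃ A b K′ w))) (trans below (sym H-total))
    deficit-one : ∀ b′ → b′ ≡ b → ⊥
    deficit-one (suc b′) refl with count-deficit-one a b′ k {0} w (≤-trans 3≤m (≤-reflexive (sym H-total))) level deficit
    ... | s , o , z , refl = no-composition-below s o z (trans (sym (length-blocks₃ s o z)) len)
      (trans (cong suc (sym (c-blocks₃-blocks₃ A b K′ s o z))) below)
    deficit-one zero refl with single-one-deficit A K′ {0} w level deficit | A + K′ + 2 ≤? zeros w
    -- With enough zeros, the level values form a two-part problem with exponents A and K′, in which
    -- H-1 is not a value.
    ... | s , t , s+t , eq | yes many-zeros =
      no-product-below-max a k (λ (a≡0 , k≡0) → nontrivial (a≡0 , refl , k≡0)) many-zeros level l l′ l+l′ refl s t s+t eq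
    ... | _ | no few = few-zeros (≤-pred (subst (zeros w <_) (+-suc (A + K′) 1) (≰⇒> few))) (ones w) refl
      where
      H-pos : 1 ≤ (l C A) × 1 ≤ (l′ C K′)
      H-pos = pos-factors (l C A) (proj₂ (pos-factors (ones w C 1) (≤-trans (s≤s z≤n) (≤-trans 3≤m (≤-reflexive (sym H-total))))))
      m≡ : ∀ {r} → suc r ≡ ones w → m ≡ suc r * ((l C A) * (l′ C K′))
      m≡ {r} r-eq = trans (sym H-total) (cong (_* H) (trans (nC1≡n (ones w)) (sym r-eq)))
      many-ones : zeros w ≤ A + K′ + 1 → 3 ≤ ones w
      many-ones few = +-cancelʳ-≤ (A + K′ + 1) 3 (ones w) (≤-trans (≤-reflexive (shift a k))
        (≤-trans large (≤-trans (≤-reflexive (sym (trans (ones+zeros w) len))) (+-monoʳ-≤ (ones w) few))))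
        where
        shift : ∀ a k → 3 + (suc a + suc k + 1) ≡ suc a + 1 + suc k + 3
        shift = solve-∀
      -- With so few zeros, `l` and `l′` cannot both exceed their exponents. On a side with
      -- equality, trading a 1 for a 0 would exceed m, as there are at least three ones.
      few-zeros : zeros w ≤ A + K′ + 1 → ∀ r → r ≡ ones w → ⊥
      few-zeros few zero r-eq = contradiction (subst (3 ≤_) (sym r-eq) (many-ones few)) λ ()
      few-zeros few (suc r) r-eq with m≤n⇒m<n∨m≡n (C-pos⁻¹ {l} {A} (proj₁ H-pos)) | m≤n⇒m<n∨m≡n (C-pos⁻¹ {l′} {K′} (proj₂ H-pos))
      ... | inj₁ A<l | inj₁ K<l′ = contradiction (≤-trans (+-mono-≤ A<l K<l′) (≤-trans (≤-reflexive l+l′) few)) (<⇒≱ (≤-reflexive (shift a k)))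
        where
        shift : ∀ a k → suc (suc a + suc k + 1) ≡ suc (suc a) + suc (suc k)
        shift = solve-∀
      ... | inj₂ A≡l | _ = extra-zero-better a r (proj₂ H-pos) (≤-pred (subst (3 ≤_) (sym r-eq) (many-ones few))) (begin
          suc A * r * (l′ C K′)                  ≡⟨ cong₂ (λ u v → u * v * (l′ C K′)) ([1+k]Ck≡1+k A) (nC1≡n r) ⟨
          weight A 1 K′ (suc A) r l′             ≤⟨ bound₃ (suc A) r l′ (trans (shift A r l′) (trans (cong₂ (λ u v → u + v + l′) A≡l r-eq) sum)) ⟩
          m                                      ≡⟨ m≡ r-eq ⟩
          suc r * ((l C A) * (l′ C K′))          ≡⟨ cong (suc r *_) (trans (cong (λ u → (u C A) * (l′ C K′)) (sym A≡l)) (trans (cong (_* (l′ C K′)) (nCn≡1 A)) (*-identityˡ _))) ⟩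
          suc r * (l′ C K′)                      ∎)
        where
        open ≤-Reasoning
        shift : ∀ u v w → suc u + v + w ≡ u + suc v + w
        shift = solve-∀
      ... | _ | inj₂ K≡l′ = extra-zero-better k r (proj₁ H-pos) (≤-pred (subst (3 ≤_) (sym r-eq) (many-ones few))) (begin
          suc K′ * r * (l C A)                   ≡⟨ perm (suc K′) r (l C A) ⟩
          (l C A) * r * suc K′                   ≡⟨ cong₂ (λ u v → (l C A) * v * u) ([1+k]Ck≡1+k K′) (nC1≡n r) ⟨
          weight A 1 K′ l r (suc K′)             ≤⟨ bound₃ l r (suc K′) (trans (shift l r K′) (trans (cong₂ (λ u v → l + v + u) K≡l′ r-eq) sum)) ⟩
          m                                      ≡⟨ m≡ r-eq ⟩
          suc r * ((l C A) * (l′ C K′))          ≡⟨ cong (suc r *_) (trans (cong (λ u → (l C A) * (u C K′)) (sym K≡l′)) (trans (cong ((l C A) *_) (nCn≡1 K′)) (*-identityʳ _))) ⟩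
          suc r * (l C A)                        ∎)
        where
        open ≤-Reasoning
        perm : ∀ u v w → u * v * w ≡ w * v * u
        perm = solve-∀
        shift : ∀ u v w → u + v + suc w ≡ u + suc v + w
        shift = solve-∀

-- Attained counts, and descent for the patterns 0 and 01

words-complete : ∀ w → w ∈ words (length w)
words-complete [] = here refl
words-complete (false ∷ w) = ∈-++⁺ˡ (∈-map⁺ (false ∷_) (words-complete w))
words-complete (true ∷ w) = ∈-++⁺ʳ (map (false ∷_) (words (length w))) (∈-map⁺ (true ∷_) (words-complete w))

words-sound : ∀ n {w} → w ∈ words n → length w ≡ n
words-sound zero (here refl) = refl
words-sound (suc n) w∈ with ∈-++⁻ (map (false ∷_) (words n)) w∈
... | inj₁ w∈₀ with ∈-map⁻ (false ∷_) w∈₀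
... | v , v∈ , refl = cong suc (words-sound n v∈)
words-sound (suc n) w∈ | inj₂ w∈₁ with ∈-map⁻ (true ∷_) w∈₁
... | v , v∈ , refl = cong suc (words-sound n v∈)

Attained : Word → ℕ → ℕ → Set
Attained p n k = ∃[ w ] (length w ≡ n × c p w ≡ k)

Full : Word → ℕ → Set
Full p n = ∀ w → length w ≡ n → ∀ k → k ≤ c p w → Attained p n k

full-by-descent : ∀ p → (∀ w → 1 ≤ c p w → ∃[ v ] (length v ≡ length w × suc (c p v) ≡ c p w)) → ∀ n → Full p n
full-by-descent p descend n w len k k≤ = go (c p w) w len refl k≤
  where
  go : ∀ d w → length w ≡ n → c p w ≡ d → k ≤ d → Attained p n k
  go d w len eq k≤d with m≤n⇒m<n∨m≡n k≤d
  ... | inj₂ k≡d = w , len , trans eq (sym k≡d)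
  go (suc d) w len eq _ | inj₁ (s≤s k≤d) with descend w (subst (1 ≤_) (sym eq) (s≤s z≤n))
  ... | v , len-v , below = go d v (trans len-v len) (suc-injective (trans below eq)) k≤d

full-0 : ∀ n → Full (false ∷ []) n
full-0 = full-by-descent (false ∷ []) descend
  where
  descend : ∀ w → 1 ≤ zeros w → ∃[ v ] (length v ≡ length w × suc (zeros v) ≡ zeros w)
  descend (false ∷ w) _ = true ∷ w , refl , refl
  descend (true ∷ w) pos with descend w pos
  ... | v , len , below = true ∷ v , cong suc len , below

full-01 : ∀ n → Full (false ∷ true ∷ []) n
full-01 = full-by-descent (false ∷ true ∷ []) λ w pos → let (v , len , _ , below) = descend w pos in v , len , below
  where
  p = false ∷ true ∷ []
  descend : ∀ w → 1 ≤ c p w → ∃[ v ] (length v ≡ length w × ones v ≡ ones w × suc (c p v) ≡ c p w)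
  descend (true ∷ w) pos with descend w pos
  ... | v , len , same , below = true ∷ v , cong suc len , cong suc same , below
  descend (false ∷ w) pos with c p w in eq
  ... | suc _ = let (v , len , same , below) = descend w (subst (1 ≤_) (sym eq) (s≤s z≤n)) in
    false ∷ v , cong suc len , same , trans (sym (+-suc (ones v) (c p v))) (cong₂ _+_ same (trans below eq))
  -- Without an occurrence of 01 but with some 1, the rest must start with 1. Swapping it with the 0
  -- in front loses exactly one occurrence and keeps the number of ones.
  ... | zero = swap w eq (subst (1 ≤_) (+-identityʳ (ones w)) pos)
    where
    swap : ∀ w → c p w ≡ 0 → 1 ≤ ones w → ∃[ v ] (length v ≡ suc (length w) × ones v ≡ ones w × suc (c p v) ≡ ones w + 0)
    swap (true ∷ w) eq _ = true ∷ false ∷ w , refl , refl , cong suc (cong (ones w +_) eq)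
    swap (false ∷ w) eq pos = contradiction (subst (1 ≤_) (m+n≡0⇒m≡0 (ones w) eq) pos) λ ()

-- The pattern 010

010ʷ : Word
010ʷ = false ∷ true ∷ false ∷ []

insert-one : ℕ → Word → Word
insert-one zero w = true ∷ w
-- A default value, excluded in the lemmas by `l + l′ ≡ zeros w`.
insert-one (suc l) [] = []
insert-one (suc l) (false ∷ w) = false ∷ insert-one l w
insert-one (suc l) (true ∷ w) = true ∷ insert-one (suc l) w

length-insert-one : ∀ l l′ w → l + l′ ≡ zeros w → length (insert-one l w) ≡ suc (length w)
length-insert-one zero l′ w _ = refl
length-insert-one (suc l) l′ (false ∷ w) e = cong suc (length-insert-one l l′ w (suc-injective e))
length-insert-one (suc l) l′ (true ∷ w) e = cong suc (length-insert-one (suc l) l′ w e)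

zeros-insert-one : ∀ l l′ w → l + l′ ≡ zeros w → zeros (insert-one l w) ≡ zeros w
zeros-insert-one zero l′ w _ = refl
zeros-insert-one (suc l) l′ (false ∷ w) e = cong suc (zeros-insert-one l l′ w (suc-injective e))
zeros-insert-one (suc l) l′ (true ∷ w) e = zeros-insert-one (suc l) l′ w e

10-insert-one : ∀ l l′ w → l + l′ ≡ zeros w → c (true ∷ false ∷ []) (insert-one l w) ≡ c (true ∷ false ∷ []) w + l′
10-insert-one zero l′ w refl = +-comm (zeros w) _
10-insert-one (suc l) l′ (false ∷ w) e = 10-insert-one l l′ w (suc-injective e)
10-insert-one (suc l) l′ (true ∷ w) e =
  trans (cong₂ _+_ (zeros-insert-one (suc l) l′ w e) (10-insert-one (suc l) l′ w e)) (sym (+-assoc (zeros w) _ l′))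

010-insert-one : ∀ l l′ w → l + l′ ≡ zeros w → c 010ʷ (insert-one l w) ≡ c 010ʷ w + l * l′
010-insert-one zero l′ w _ = sym (+-identityʳ _)
010-insert-one (suc l) l′ (false ∷ w) e =
  trans (cong₂ _+_ (10-insert-one l l′ w (suc-injective e)) (010-insert-one l l′ w (suc-injective e)))
    (regroup (c (true ∷ false ∷ []) w) l′ (c 010ʷ w) (l * l′))
  where
  regroup : ∀ u v x y → (u + v) + (x + y) ≡ (u + x) + (v + y)
  regroup = solve-∀
010-insert-one (suc l) l′ (true ∷ w) e = 010-insert-one (suc l) l′ w e

data SumOfSquares : ℕ → ℕ → Set where
  none : SumOfSquares 0 0
  _²+_ : ∀ d {r D} → SumOfSquares r D → SumOfSquares (suc r) (d * d + D)

private
  square : Fin 6 → ℕ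
  square d = toℕ d * toℕ d

abstract
  -- The range D ≤ 25 is (r+1)² for r = 4, and no root above 5 can occur.
  four-squares-table : ∀ (D : Fin 26) → ∃[ s ] ∃[ t ] ∃[ u ] ∃[ v ] square s + (square t + (square u + (square v + 0))) ≡ toℕ D
  four-squares-table = from-yes (all? {n = 26} λ D → any? λ s → any? λ t → any? λ u → any? λ v →
    square s + (square t + (square u + (square v + 0))) ≟ toℕ D)

four-squares : ∀ {D} → D ≤ 25 → SumOfSquares 4 D
four-squares {D} D≤25 with four-squares-table (fromℕ< (s≤s D≤25))
... | s , t , u , v , eq = subst (SumOfSquares 4) (trans eq (toℕ-fromℕ< (s≤s D≤25)))
    (toℕ s ²+ (toℕ t ²+ (toℕ u ²+ (toℕ v ²+ none))))

-- For r ≥ 4; the remainder of D after the largest admissible square is small enough for induction on r.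
sum-of-squares : ∀ j {D} → D ≤ (5 + j) * (5 + j) → SumOfSquares (4 + j) D
sum-of-squares zero D≤ = four-squares D≤
sum-of-squares (suc j) {D} D≤ with D ≤? (5 + j) * (5 + j)
... | yes small = 0 ²+ sum-of-squares j small
... | no large with m≤n⇒∃[o]m+o≡n (<⇒≤ (≰⇒> large))
... | D′ , refl = (5 + j) ²+ sum-of-squares j (≤-trans
    (+-cancelˡ-≤ ((5 + j) * (5 + j)) D′ (11 + 2 * j) (≤-trans D≤ (≤-reflexive (square-suc j))))
    (≤-trans (m≤m+n (11 + 2 * j) (14 + 8 * j + j * j)) (≤-reflexive (expand j))))
  where
  square-suc : ∀ j → (5 + suc j) * (5 + suc j) ≡ (5 + j) * (5 + j) + (11 + 2 * j)
  square-suc = solve-∀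
  expand : ∀ j → 11 + 2 * j + (14 + 8 * j + j * j) ≡ (5 + j) * (5 + j)
  expand = solve-∀

-- Ones placed d levels away from the middle of 0^(2q) contribute q² - d² each.
word-of-squares : ∀ q {r D} → SumOfSquares r D → D ≤ q * q →
  ∃[ w ] (length w ≡ r + (q + q) × zeros w ≡ q + q × c 010ʷ w + D ≡ r * (q * q))
word-of-squares q none _ = replicate (q + q) false , length-replicate (q + q) , zeros-replicate-false (q + q) ,
  trans (+-identityʳ _) (no-one (q + q))
  where
  no-one : ∀ z → c 010ʷ (replicate z false) ≡ 0
  no-one zero = refl
  no-one (suc z) = cong₂ _+_ (no-one′ z) (no-one z)
    where
    no-one′ : ∀ z → c (true ∷ false ∷ []) (replicate z false) ≡ 0
    no-one′ zero = refl
    no-one′ (suc z) = no-one′ z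
word-of-squares q (_²+_ d {r} {D} squares) D≤ with d ≤? q
... | no d≰q = contradiction (≤-trans (m≤m+n (d * d) D) D≤) (<⇒≱ (*-mono-< (≰⇒> d≰q) (≰⇒> d≰q)))
... | yes d≤q with m≤n⇒∃[o]m+o≡n d≤q
... | e , refl with word-of-squares (d + e) squares (≤-trans (m≤n+m D (d * d)) D≤)
-- With q = d + e, the new 1 has q + d zeros before it and q - d behind it, hence contributes q² -
-- d².
... | w , len , zs , value = insert-one (d + (d + e)) w ,
    trans (length-insert-one (d + (d + e)) e w level) (cong suc len) ,
    trans (zeros-insert-one (d + (d + e)) e w level) zs ,
    trans (cong (_+ (d * d + D)) (010-insert-one (d + (d + e)) e w level))
      (trans (regroup (c 010ʷ w) d e D) (cong ((d + e) * (d + e) +_) value))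
  where
  level : d + (d + e) + e ≡ zeros w
  level = trans (shift d e) (sym zs)
    where
    shift : ∀ d e → d + (d + e) + e ≡ (d + e) + (d + e)
    shift = solve-∀
  regroup : ∀ x d e D → x + (d + (d + e)) * e + (d * d + D) ≡ (d + e) * (d + e) + (x + D)
  regroup = solve-∀

attained-suc : ∀ {n k} → Attained 010ʷ n k → Attained 010ʷ (suc n) k
attained-suc (w , len , value) = true ∷ w , cong suc len , value

abstract
  -- There are 2q zeros, and the truncated difference is the number of ones. It is 0 when 2q exceeds
  -- the length, which leaves only k = 0.
  attained-small : ∀ (i : Fin 5) (q : Fin 6) (k : Fin (suc ((7 + toℕ i ∸ (toℕ q + toℕ q)) * (toℕ q * toℕ q)))) →
    toℕ k ∈ map (c 010ʷ) (words (7 + toℕ i))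
  attained-small = from-yes (all? {n = 5} λ i → all? {n = 6} λ q →
    all? {n = suc ((7 + toℕ i ∸ (toℕ q + toℕ q)) * (toℕ q * toℕ q))} λ k → toℕ k ∈? map (c 010ʷ) (words (7 + toℕ i)))

∈⇒Attained : ∀ {p n k} → k ∈ map (c p) (words n) → Attained p n k
∈⇒Attained {p} {n} k∈ with ∈-map⁻ (c p) k∈
... | w , w∈ , eq = w , words-sound n w∈ , sym eq

attained-below-12 : ∀ i → i < 5 → ∀ {q r k} → r + (q + q) ≡ 7 + i → k ≤ r * (q * q) → Attained 010ʷ (7 + i) k
attained-below-12 i i<5 {q} {r} {k} eq k≤ =
  subst (Attained 010ʷ (7 + i)) (toℕ-fromℕ< k<)
    (∈⇒Attained {010ʷ} (subst (λ j → toℕ (fromℕ< k<) ∈ map (c 010ʷ) (words (7 + j))) (toℕ-fromℕ< i<5)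
      (lookup (fromℕ< i<5) (fromℕ< q<6) (toℕ-fromℕ< i<5) (toℕ-fromℕ< q<6))))
  where
  k< : k < suc (r * (q * q))
  k< = s≤s k≤
  q<6 : q < 6
  q<6 = ≰⇒> λ 6≤q → <⇒≱ (+-monoʳ-< 7 i<5) (≤-trans (≤-trans (+-mono-≤ 6≤q 6≤q) (m≤n+m (q + q) r)) (≤-reflexive eq))
  lookup : ∀ (i′ : Fin 5) (q′ : Fin 6) → toℕ i′ ≡ i → toℕ q′ ≡ q → toℕ (fromℕ< k<) ∈ map (c 010ʷ) (words (7 + toℕ i′))
  lookup i′ q′ refl refl = subst (_∈ map (c 010ʷ) (words (7 + toℕ i′))) (trans (toℕ-fromℕ< k<′) (sym (toℕ-fromℕ< k<)))
    (attained-small i′ q′ (fromℕ< k<′))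
    where
    k<′ : k < suc ((7 + toℕ i′ ∸ (toℕ q′ + toℕ q′)) * (toℕ q′ * toℕ q′))
    k<′ = subst (λ u → k < suc (u * (toℕ q′ * toℕ q′))) (trans (sym (m+n∸n≡m r (toℕ q′ + toℕ q′))) (cong (_∸ (toℕ q′ + toℕ q′)) eq)) k<

-- At length 12 or more, q ≤ r + 1 forces r ≥ 4. Then k ≤ (r-1) q² comes from the previous length,
-- since a leading 1 adds no occurrence. For larger k the difference r q² - k is at most q² ≤
-- (r+1)², hence a sum of r squares.
attained-above-11 : ∀ j q {r k} → r + (q + q) ≡ 11 + j → k ≤ r * (q * q) → Attained 010ʷ (11 + j) k
attained-above-11 zero q {r} eq k≤ = attained-below-12 4 ≤-refl {q} {r} eq k≤
attained-above-11 (suc j) q {r} {k} eq k≤ with q ≤? suc r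
attained-above-11 (suc j) zero {r} eq k≤ | no q≰ = contradiction z≤n q≰
-- Few ones: two zeros are better replaced by ones.
attained-above-11 (suc j) (suc q) {r} {k} eq k≤ | no q≰ = attained-above-11 (suc j) q {suc (suc r)}
  (trans (shift r q) eq) (≤-trans k≤ (improve (≤-pred (≰⇒> q≰))))
  where
  shift : ∀ r q → suc (suc r) + (q + q) ≡ r + (suc q + suc q)
  shift = solve-∀
  improve : suc r ≤ q → r * (suc q * suc q) ≤ suc (suc r) * (q * q)
  improve r<q with m≤n⇒∃[o]m+o≡n r<q
  ... | d , refl = ≤-trans (m≤m+n _ (2 + r + 4 * d + 2 * (d * d) + 2 * (r * d))) (≤-reflexive (expand r d))
    where
    expand : ∀ r d → r * (suc (suc r + d) * suc (suc r + d)) + (2 + r + 4 * d + 2 * (d * d) + 2 * (r * d))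
      ≡ suc (suc r) * ((suc r + d) * (suc r + d))
    expand = solve-∀
attained-above-11 (suc j) q {r} {k} eq k≤ | yes q≤ with m≤n⇒∃[o]m+o≡n (4≤r q≤)
  where
  4≤r : q ≤ suc r → 4 ≤ r
  4≤r q≤ = ≰⇒> λ r≤3 → <⇒≱ (s≤s (m≤m+n 11 j))
    (≤-trans (≤-reflexive (sym eq)) (+-mono-≤ r≤3 (+-mono-≤ (≤-trans q≤ (s≤s r≤3)) (≤-trans q≤ (s≤s r≤3)))))
... | i , refl with k ≤? (3 + i) * (q * q)
... | yes k≤′ = attained-suc (attained-above-11 j q {3 + i} (suc-injective eq) k≤′)
... | no k≰ with m≤n⇒∃[o]m+o≡n k≤
... | D , k+D = fromSquares (word-of-squares q (sum-of-squares i (≤-trans D≤ (*-mono-≤ q≤ q≤))) D≤)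
  where
  D≤ : D ≤ q * q
  D≤ = +-cancelˡ-≤ k D (q * q) (≤-trans (≤-reflexive k+D)
    (≤-trans (+-monoʳ-≤ (q * q) (<⇒≤ (≰⇒> k≰))) (≤-reflexive (+-comm (q * q) k))))
  fromSquares : ∃[ w ] (length w ≡ 4 + i + (q + q) × zeros w ≡ q + q × c 010ʷ w + D ≡ (4 + i) * (q * q)) → Attained 010ʷ (12 + j) k
  fromSquares (w , len , _ , value) = w , trans len eq , +-cancelʳ-≡ D _ _ (trans value (sym k+D))

attained-balanced : ∀ {n} → 7 ≤ n → ∀ q {r k} → r + (q + q) ≡ n → k ≤ r * (q * q) → Attained 010ʷ n k
attained-balanced {n} 7≤n q {r} eq k≤ with n ≤? 11 | m≤n⇒∃[o]m+o≡n 7≤n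
... | yes n≤11 | i , refl = attained-below-12 i (+-cancelˡ-≤ 7 (suc i) 5 (≤-trans (≤-reflexive (+-suc 7 i)) (s≤s n≤11))) {q} {r} eq k≤
... | no n≰11 | _ with m≤n⇒∃[o]m+o≡n (<⇒≤ (≰⇒> n≰11))
... | j , refl = attained-above-11 j q {r} eq k≤

-- For the smaller factor i = q - e the other is q′ + e, and the product exceeds q q′ by e (i - q′)
-- ≤ 0.
product-bound : ∀ {q q′ i j} → q ≤ q′ → q′ ≤ suc q → i + j ≡ q + q′ → i * j ≤ q * q′
product-bound {q} {q′} {i} {j} q≤q′ q′≤1+q eq = [ (λ i≤j → ordered i j i≤j eq)
  , (λ j≤i → subst (_≤ q * q′) (*-comm j i) (ordered j i j≤i (trans (+-comm j i) eq))) ]′ (≤-total i j)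
  where
  ordered : ∀ i j → i ≤ j → i + j ≡ q + q′ → i * j ≤ q * q′
  ordered i j i≤j eq with i ≤? q
  ... | no i≰q = contradiction (≤-reflexive eq) (<⇒≱ (+-mono-<-≤ (≰⇒> i≰q) (≤-trans q′≤1+q (≤-trans (≰⇒> i≰q) i≤j))))
  ... | yes i≤q with m≤n⇒∃[o]m+o≡n i≤q
  ... | e , refl = begin
    i * j           ≡⟨ cong (i *_) (+-cancelˡ-≡ i j (e + q′) (trans eq (+-assoc i e q′))) ⟩
    i * (e + q′)    ≡⟨ *-distribˡ-+ i e q′ ⟩
    i * e + i * q′  ≤⟨ +-monoˡ-≤ (i * q′) (*-monoˡ-≤ e (≤-trans i≤q q≤q′)) ⟩
    q′ * e + i * q′ ≡⟨ regroup q′ e i ⟩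
    (i + e) * q′    ∎
    where
    open ≤-Reasoning
    regroup : ∀ u e i → u * e + i * u ≡ (i + e) * u
    regroup = solve-∀

parity : ∀ z → ∃[ q ] (z ≡ q + q ⊎ z ≡ q + suc q)
parity zero = 0 , inj₁ refl
parity (suc z) with parity z
... | q , inj₁ refl = q , inj₂ (sym (+-suc q q))
... | q , inj₂ refl = suc q , inj₁ refl

c-010-≤ : ∀ {q q′} w → q ≤ q′ → q′ ≤ suc q → zeros w ≡ q + q′ → c 010ʷ w ≤ ones w * (q * q′)
c-010-≤ {q} {q′} w q≤q′ q′≤1+q z-eq = begin
  c 010ʷ w                       ≡⟨ c-blocks₃ 1 0 1 w ⟩
  offsetCount 1 0 1 0 w          ≤⟨ offsetCount-≤ 1 0 1 w (λ i j eq → subst₂ (λ u v → u * v ≤ q * q′) (sym (nC1≡n i)) (sym (nC1≡n j))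
                                      (product-bound {i = i} {j} q≤q′ q′≤1+q (trans eq z-eq))) ⟩
  (ones w C 1) * (q * q′)        ≡⟨ cong (_* (q * q′)) (nC1≡n (ones w)) ⟩
  ones w * (q * q′)              ∎
  where open ≤-Reasoning

full-010 : ∀ {n} → 7 ≤ n → Full 010ʷ n
full-010 {n} 7≤n w len k k≤ with parity (zeros w)
... | q , inj₁ even = attained-balanced 7≤n q {ones w} (trans (cong (ones w +_) (sym even)) (trans (ones+zeros w) len))
  (≤-trans k≤ (c-010-≤ w ≤-refl (n≤1+n q) even))
... | q , inj₂ odd = by-ones (ones w) (trans (cong (ones w +_) (sym odd)) (trans (ones+zeros w) len))
  (≤-trans k≤ (c-010-≤ w (n≤1+n q) ≤-refl odd))
  where
  -- An odd number of zeros is never better than one of its two even neighbours.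
  by-ones : ∀ r → r + (q + suc q) ≡ n → k ≤ r * (q * suc q) → Attained 010ʷ n k
  by-ones r eq k≤ with r ≤? q
  ... | yes r≤q = attained-balanced 7≤n q {suc r} (trans (shift r q) eq) (≤-trans k≤ (begin
      r * (q * suc q)       ≡⟨ expand r q ⟩
      r * q + r * (q * q)   ≤⟨ +-monoˡ-≤ (r * (q * q)) (*-monoˡ-≤ q r≤q) ⟩
      suc r * (q * q)       ∎))
    where
    open ≤-Reasoning
    shift : ∀ r q → suc r + (q + q) ≡ r + (q + suc q)
    shift = solve-∀
    expand : ∀ r q → r * (q * suc q) ≡ r * q + r * (q * q)
    expand = solve-∀
  by-ones zero eq k≤ | no r≰q = contradiction z≤n r≰q
  by-ones (suc r) eq k≤ | no r≰q = attained-balanced 7≤n (suc q) {r} (trans (shift r q) eq) (≤-trans k≤ (begin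
      suc r * (q * suc q)               ≡⟨ expand r q ⟩
      q * suc q + r * (q * suc q)       ≤⟨ +-monoˡ-≤ (r * (q * suc q)) (*-monoˡ-≤ (suc q) (≤-pred (≰⇒> r≰q))) ⟩
      r * suc q + r * (q * suc q)       ≡⟨ collect r q ⟩
      r * (suc q * suc q)               ∎))
    where
    open ≤-Reasoning
    shift : ∀ r q → r + (suc q + suc q) ≡ suc r + (q + suc q)
    shift = solve-∀
    expand : ∀ r q → suc r * (q * suc q) ≡ q * suc q + r * (q * suc q)
    expand = solve-∀
    collect : ∀ r q → r * suc q + r * (q * suc q) ≡ r * (suc q * suc q)
    collect = solve-∀

-- From attained counts to B and M

length≢0⇒∃∈ : ∀ {A : Set} (xs : List A) → length xs ≢ 0 → ∃[ x ] x ∈ xs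
length≢0⇒∃∈ [] ne = contradiction refl ne
length≢0⇒∃∈ (x ∷ xs) _ = x , here refl

∈⇒length≢0 : ∀ {A : Set} {x : A} {xs} → x ∈ xs → length xs ≢ 0
∈⇒length≢0 (here _) ()
∈⇒length≢0 (there _) ()

B≢0⇒Attained : ∀ n p k → ¬ (B n p k ≡ 0) → Attained p n k
B≢0⇒Attained n p k ne with length≢0⇒∃∈ (filter (λ w → c p w ≟ k) (words n)) ne
... | w , w∈ with ∈-filter⁻ (λ w → c p w ≟ k) {xs = words n} w∈
... | w∈words , eq = w , words-sound n w∈words , eq

Attained⇒B≢0 : ∀ n p k → Attained p n k → ¬ (B n p k ≡ 0)
Attained⇒B≢0 n p k (w , len , eq) =
  ∈⇒length≢0 (∈-filter⁺ (λ w → c p w ≟ k) (subst (λ l → w ∈ words l) len (words-complete w)) eq)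

∈⇒≤foldr-⊔ : ∀ {x xs} → x ∈ xs → x ≤ foldr _⊔_ 0 xs
∈⇒≤foldr-⊔ {xs = y ∷ ys} (here refl) = m≤m⊔n y (foldr _⊔_ 0 ys)
∈⇒≤foldr-⊔ {xs = y ∷ ys} (there x∈) = ≤-trans (∈⇒≤foldr-⊔ x∈) (m≤n⊔m y (foldr _⊔_ 0 ys))

c≤M : ∀ n p w → length w ≡ n → c p w ≤ M n p
c≤M n p w refl = ∈⇒≤foldr-⊔ (∈-map⁺ (c p) (words-complete w))

M-Attained : ∀ n p → Attained p n (M n p)
M-Attained n p with foldr-selective ⊔-sel 0 (map (c p) (words n))
... | inj₂ M∈ = ∈⇒Attained {p} M∈
... | inj₁ M≡0 = replicate n false , length-replicate n ,
  ≤-antisym (c≤M n p (replicate n false) (length-replicate n)) (≤-trans (≤-reflexive M≡0) z≤n)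

-- Complementing letters, and internal zeros from gaps

flip : Word → Word
flip = map not

flip-involutive : ∀ w → flip (flip w) ≡ w
flip-involutive w = trans (sym (map-∘ w)) (trans (map-cong not-involutive w) (map-id w))

c-flip : ∀ p w → c (flip p) (flip w) ≡ c p w
c-flip [] w = refl
c-flip (x ∷ p) [] = refl
c-flip (false ∷ p) (false ∷ w) = cong₂ _+_ (c-flip p w) (c-flip (false ∷ p) w)
c-flip (false ∷ p) (true ∷ w) = c-flip (false ∷ p) w
c-flip (true ∷ p) (false ∷ w) = c-flip (true ∷ p) w
c-flip (true ∷ p) (true ∷ w) = cong₂ _+_ (c-flip p w) (c-flip (true ∷ p) w)

c-flipʳ : ∀ p w → c p (flip w) ≡ c (flip p) w
c-flipʳ p w = trans (cong (λ q → c q (flip w)) (sym (flip-involutive p))) (c-flip (flip p) w)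

full-flip : ∀ p {n} → Full (flip p) n → Full p n
full-flip p full w len k k≤ with full (flip w) (trans (length-map not w) len) k (≤-trans k≤ (≤-reflexive (sym (c-flip p w))))
... | v , len-v , eq = flip v , trans (length-map not v) len-v , trans (c-flipʳ p v) eq

gap-flip : ∀ p {n} → Gap (flip p) n → Gap p n
gap-flip p gap {m} bound w₀ len₀ max
  with gap {m} (λ w len → ≤-trans (≤-reflexive (sym (c-flipʳ p w))) (bound (flip w) (trans (length-map not w) len)))
    (flip w₀) (trans (length-map not w₀) len₀) (trans (c-flip p w₀) max)
... | 3≤m , no-below = 3≤m , λ w len below →
  no-below (flip w) (trans (length-map not w) len) (trans (cong suc (c-flip p w)) below)

c-avoid : ∀ x p n → c (x ∷ p) (replicate n (not x)) ≡ 0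
c-avoid x p zero = refl
c-avoid false p (suc n) = c-avoid false p n
c-avoid true p (suc n) = c-avoid true p n

full⇒¬HasInternalZero : ∀ p n → Full p n → ¬ HasInternalZero n p
full⇒¬HasInternalZero p n full (_ , k₂ , k₃ , _ , k₂<k₃ , _ , B₃ , B₂) with B≢0⇒Attained n p k₃ B₃
... | w , len , refl = Attained⇒B≢0 n p k₂ (full w len k₂ (<⇒≤ k₂<k₃)) B₂

-- The witnesses are 0, m-1 and m; the count 0 is attained by the constant word in the letter other
-- than `x`.
gap⇒HasInternalZero : ∀ x p n → Gap (x ∷ p) n → HasInternalZero n (x ∷ p) × B n (x ∷ p) (M n (x ∷ p) ∸ 1) ≡ 0
gap⇒HasInternalZero x p n gap with M-Attained n (x ∷ p)
... | w₀ , len₀ , max with gap (c≤M n (x ∷ p)) w₀ len₀ max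
... | 3≤M , no-below =
    (0 , m ∸ 1 , m , <⇒≤ (∸-monoˡ-≤ 1 3≤M) , ∸-monoʳ-< {o = 0} (s≤s z≤n) (<⇒≤ (<⇒≤ 3≤M))
      , Attained⇒B≢0 n (x ∷ p) 0 (replicate n (not x) , length-replicate n , c-avoid x p n)
      , Attained⇒B≢0 n (x ∷ p) m (w₀ , len₀ , max) , B≡0)
  , B≡0
  where
  m = M n (x ∷ p)
  B≡0 : B n (x ∷ p) (m ∸ 1) ≡ 0
  B≡0 with B n (x ∷ p) (m ∸ 1) ≟ 0
  ... | yes eq = eq
  ... | no ne with B≢0⇒Attained n (x ∷ p) (m ∸ 1) ne
  ... | w , len , eq = contradiction (trans (cong suc eq) (m+[n∸m]≡n (<⇒≤ (<⇒≤ 3≤M)))) (no-below w len)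

-- Decomposition into runs

leading-run : ∀ x p → ∃[ s ] ∃[ rest ] (p ≡ replicate s x ++ rest × (∀ k → runsFrom x k p ≡ (k + s) ∷ runLengths rest)
  × (rest ≡ [] ⊎ ∃[ rest′ ] rest ≡ not x ∷ rest′))
leading-run x [] = 0 , [] , refl , (λ k → cong (_∷ []) (sym (+-identityʳ k))) , inj₁ refl
leading-run false (true ∷ p) = 0 , true ∷ p , refl , (λ k → cong (_∷ runsFrom true 1 p) (sym (+-identityʳ k))) , inj₂ (p , refl)
leading-run true (false ∷ p) = 0 , false ∷ p , refl , (λ k → cong (_∷ runsFrom false 1 p) (sym (+-identityʳ k))) , inj₂ (p , refl)
leading-run false (false ∷ p) with leading-run false p
... | s , rest , eq , runs , next = suc s , rest , cong (false ∷_) eq ,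
  -- Each letter of the run raises the accumulator of `runsFrom`, hence the claim for every starting
  -- value `k`.
  (λ k → trans (runs (suc k)) (cong (_∷ runLengths rest) (sym (+-suc k s)))) , next
leading-run true (true ∷ p) with leading-run true p
... | s , rest , eq , runs , next = suc s , rest , cong (true ∷_) eq ,
  (λ k → trans (runs (suc k)) (cong (_∷ runLengths rest) (sym (+-suc k s)))) , next

run : ℕ → Bool → Word
run a x = replicate (suc a) x

-- The second index carries the run lengths, so that matching on `All (_≡ 1)` fixes the exponents.
-- All run lengths are successors, as `run` requires.
data AtMostThreeRuns : Word → List ℕ → Set where
  zero-runs  : AtMostThreeRuns [] []
  one-run    : ∀ x a → AtMostThreeRuns (run a x) (suc a ∷ [])
  two-runs   : ∀ x a b → AtMostThreeRuns (run a x ++ run b (not x)) (suc a ∷ suc b ∷ [])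
  three-runs : ∀ x a b k → AtMostThreeRuns (run a x ++ (run b (not x) ++ run k x)) (suc a ∷ suc b ∷ suc k ∷ [])

first-run : ∀ x p → ∃[ s ] ∃[ rest ] (x ∷ p ≡ run s x ++ rest × runLengths (x ∷ p) ≡ suc s ∷ runLengths rest
  × (rest ≡ [] ⊎ ∃[ rest′ ] rest ≡ not x ∷ rest′))
first-run x p with leading-run x p
... | s , rest , eq , runs , next = s , rest , cong (x ∷_) eq , runs 1 , next

at-most-three-runs : ∀ p → numRuns p ≤ 3 → AtMostThreeRuns p (runLengths p)
at-most-three-runs [] _ = zero-runs
at-most-three-runs (x ∷ p) le with first-run x p
... | a , .[] , eq₁ , runs₁ , inj₁ refl =
  subst₂ AtMostThreeRuns (sym (trans eq₁ (++-identityʳ _))) (sym runs₁) (one-run x a)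
... | a , .(not x ∷ p₂) , eq₁ , runs₁ , inj₂ (p₂ , refl) with first-run (not x) p₂
... | b , .[] , eq₂ , runs₂ , inj₁ refl = subst₂ AtMostThreeRuns
  (sym (trans eq₁ (cong (run a x ++_) (trans eq₂ (++-identityʳ _)))))
  (sym (trans runs₁ (cong (suc a ∷_) runs₂))) (two-runs x a b)
... | b , .(not (not x) ∷ p₃) , eq₂ , runs₂ , inj₂ (p₃ , refl) with first-run x p₃ | not-involutive x
... | k , rest , eq₃ , runs₃ , next | ¬¬x≡x with subst (λ y → y ∷ p₃ ≡ run k x ++ rest) (sym ¬¬x≡x) eq₃
  | trans runs₁ (cong (suc a ∷_) (trans runs₂ (cong (suc b ∷_) (trans (cong (λ y → runLengths (y ∷ p₃)) ¬¬x≡x) runs₃))))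
... | eq₃′ | runs with next
... | inj₁ refl = subst₂ AtMostThreeRuns
  (sym (trans eq₁ (cong (run a x ++_) (trans eq₂ (cong (run b (not x) ++_) (trans eq₃′ (++-identityʳ _)))))))
  (sym runs) (three-runs x a b k)
... | inj₂ (p₄ , refl) with first-run (not x) p₄
... | l , rest′ , _ , runs₄ , _ = contradiction (subst (_≤ 3) (cong length (trans runs (cong (λ u → suc a ∷ suc b ∷ suc k ∷ u) runs₄))) le) λ where (s≤s (s≤s (s≤s ())))

run₁-gap : ∀ x a {n} → a ≢ 0 → length (run a x) + 3 ≤ n → Gap (run a x) n
run₁-gap x zero a≢0 _ = contradiction refl a≢0
run₁-gap false (suc a) {n} _ le = gap₁ a (subst (λ l → l + 3 ≤ n) (length-replicate (suc (suc a))) le)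
run₁-gap true (suc a) {n} _ le = gap-flip (run (suc a) true) (subst (λ p → Gap p n) (sym (map-replicate not (suc (suc a)) true))
  (gap₁ a (subst (λ l → l + 3 ≤ n) (length-replicate (suc (suc a))) le)))

run₂-gap : ∀ x a b {n} → ¬ (a ≡ 0 × b ≡ 0) → length (run a x ++ run b (not x)) + 3 ≤ n → Gap (run a x ++ run b (not x)) n
run₂-gap x a b {n} nontrivial le = by-letter x (subst (λ l → l + 3 ≤ n)
  (trans (length-++ (run a x)) (cong₂ _+_ (length-replicate (suc a)) (length-replicate (suc b)))) le)
  where
  by-letter : ∀ x → suc a + suc b + 3 ≤ n → Gap (run a x ++ run b (not x)) n
  by-letter true = gap₂ a b nontrivial
  by-letter false le = gap-flip (run a false ++ run b true) (subst (λ p → Gap p n)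
    (sym (trans (map-++ not (run a false) (run b true)) (cong₂ _++_ (map-replicate not (suc a) false) (map-replicate not (suc b) true))))
    (gap₂ a b nontrivial le))

run₃-gap : ∀ x a b k {n} → ¬ (a ≡ 0 × b ≡ 0 × k ≡ 0) → length (run a x ++ (run b (not x) ++ run k x)) + 3 ≤ n →
  Gap (run a x ++ (run b (not x) ++ run k x)) n
run₃-gap x a b k {n} nontrivial le = by-letter x (subst (λ l → l + 3 ≤ n)
  (trans (length-++ (run a x)) (trans (cong₂ _+_ (length-replicate (suc a))
    (trans (length-++ (run b (not x))) (cong₂ _+_ (length-replicate (suc b)) (length-replicate (suc k)))))
    (sym (+-assoc (suc a) (suc b) (suc k))))) le)
  where
  by-letter : ∀ x → suc a + suc b + suc k + 3 ≤ n → Gap (run a x ++ (run b (not x) ++ run k x)) n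
  by-letter false = gap₃ a b k nontrivial
  by-letter true le = gap-flip (run a true ++ (run b false ++ run k true)) (subst (λ p → Gap p n)
    (sym (trans (map-++ not (run a true) (run b false ++ run k true)) (cong₂ _++_ (map-replicate not (suc a) true)
      (trans (map-++ not (run b false) (run k true)) (cong₂ _++_ (map-replicate not (suc b) false) (map-replicate not (suc k) true))))))
    (gap₃ a b k nontrivial le))

alternating-full : ∀ {p rs} → AtMostThreeRuns p rs → All (_≡ 1) rs → p ≢ [] → ∀ n → 7 ≤ n → Full p n
alternating-full zero-runs _ ne = contradiction refl ne
alternating-full (one-run false .0) (refl ∷ []) _ n _ = full-0 n
alternating-full (one-run true .0) (refl ∷ []) _ n _ = full-flip (run 0 true) (full-0 n)
alternating-full (two-runs false .0 .0) (refl ∷ refl ∷ []) _ n _ = full-01 n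
alternating-full (two-runs true .0 .0) (refl ∷ refl ∷ []) _ n _ = full-flip (run 0 true ++ run 0 false) (full-01 n)
alternating-full (three-runs false .0 .0 .0) (refl ∷ refl ∷ refl ∷ []) _ n 7≤n = full-010 7≤n
alternating-full (three-runs true .0 .0 .0) (refl ∷ refl ∷ refl ∷ []) _ n 7≤n =
  full-flip (run 0 true ++ (run 0 false ++ run 0 true)) (full-010 7≤n)

non-alternating-gap : ∀ {p rs} → AtMostThreeRuns p rs → ¬ All (_≡ 1) rs → ∀ {n} → length p + 3 ≤ n → Gap p n
non-alternating-gap zero-runs non-alt = contradiction [] non-alt
non-alternating-gap (one-run x a) non-alt = run₁-gap x a λ a≡0 → non-alt (cong suc a≡0 ∷ [])
non-alternating-gap (two-runs x a b) non-alt = run₂-gap x a b λ (a≡0 , b≡0) → non-alt (cong suc a≡0 ∷ cong suc b≡0 ∷ [])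
non-alternating-gap (three-runs x a b k) non-alt =
  run₃-gap x a b k λ (a≡0 , b≡0 , k≡0) → non-alt (cong suc a≡0 ∷ cong suc b≡0 ∷ cong suc k≡0 ∷ [])

-- Every word contains the empty pattern exactly once, so only the count 1 is attained.
empty-¬HasInternalZero : ∀ n → ¬ HasInternalZero n []
empty-¬HasInternalZero n (k₁ , _ , k₃ , k₁<k₂ , k₂<k₃ , B₁ , B₃ , _)
  with B≢0⇒Attained n [] k₁ B₁ | B≢0⇒Attained n [] k₃ B₃
... | _ , _ , refl | _ , _ , refl = <-irrefl refl (<-trans k₁<k₂ k₂<k₃)

mainTheorem12 : (p : Word) → numRuns p ≤ 3 →
    ((Alternating p → (n : ℕ) → 7 ≤ n → ¬ HasInternalZero n p)
    × (¬ Alternating p → (n : ℕ) → length p + 3 ≤ n →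
    HasInternalZero n p × B n p (M n p ∸ 1) ≡ 0))
mainTheorem12 [] _ = (λ _ n _ → empty-¬HasInternalZero n) , λ non-alt → contradiction [] non-alt
mainTheorem12 p@(x ∷ q) runs≤3 =
    (λ alt n 7≤n → full⇒¬HasInternalZero p n (alternating-full runs alt (λ ()) n 7≤n))
  , (λ non-alt n large → gap⇒HasInternalZero x q n (non-alternating-gap runs non-alt large))
  where
  runs = at-most-three-runs p runs≤3
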